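{- (a) The following expressions are $e$-positive: (i) $z^2E''(z)-zE'(z)+e_1z$; (ii) $2z^2E''(z)-3zE'(z)+3e_1z+2e_2z^2$; (iii) $z^2E''(z)-3zE'(z)+3E(z)+e_2z^2$. (b) The following expressions can be written as rational functions with $e$-positive numerators: (i) $\mathcal{X}_P(z)-(1+e_1z)$; (ii) $(1+e_1z)\,\mathcal{X}_C(z)-\mathcal{X}_P(z)+1+e_1z$.
   Context: $e_i$ is the $i$-th elementary symmetric function ($e_0=1$), $E(z)=\sum_{i\ge 0}e_iz^i$, and derivatives are with respect to $z$. A power series in $z$ over symmetric functions is $e$-positive if each coefficient has nonnegative coefficients in the basis of elementary symmetric functions $e_\lambda$. The chromatic symmetric function of a finite simple graph $H=(V,E)$ is $X_H=\sum_\kappa\prod_{u\in V}x_{\kappa(u)}$, the sum over all proper colorings $\kappa:V\to\mathbb{Z}_{>0}$. $P_n$ and $C_n$ are the path and cycle on $n$ vertices (with $X_{P_0}=1$ and $X_{C_2}=2e_2$); $\mathcal{X}_P(z)=\sum_{n\ge 0}X_{P_n}z^n$ and $\mathcal{X}_C(z)=\sum_{n\ge 2}X_{C_n}z^n$. It is known (Stanley) that $\mathcal{X}_P(z)=E(z)/D(z)$ and $\mathcal{X}_C(z)=z^2E''(z)/D(z)$, where $D(z)=E(z)-zE'(z)=1-\sum_{i\ge 2}(i-1)e_iz^i$. -}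

module Defs where

open import Level using (0ℓ)
open import Algebra.Bundles.Raw using (RawRing)
import Algebra.Definitions.RawSemiring as RawSemiringDefs
open import Data.Bool.Base using (true; false)
open import Data.Nat.Base as ℕ using (ℕ; zero; suc; _∸_; _≥_)
import Data.Nat.Properties as ℕₚ
import Data.Integer.Base as ℤ
open import Data.Fin.Base using (Fin; zero; suc; toℕ)
open import Data.Fin.Properties using (all?) renaming (_≟_ to _≟ᶠ_)
open import Data.Fin.Subset using (Subset; ∣_∣)
open import Data.Fin.Subset.Properties using (_∈?_)
open import Data.List.Base using (List; []; _∷_; [_]; foldr; filter; upTo; allFin; cartesianProductWith)
open import Data.List.Relation.Unary.All using (All)
open import Data.List.Relation.Unary.Linked using (Linked)
open import Data.Product.Base using (Σ-syntax; _×_; _,_)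
open import Data.Sum.Base using (_⊎_; inj₁; inj₂; swap)
open import Data.Vec.Base using (Vec; []; _∷_; lookup)
open import Relation.Binary.Core using (Rel)
open import Relation.Binary.Definitions using (Decidable; Symmetric; Irreflexive)
open import Relation.Binary.PropositionalEquality using (_≡_; _≢_; refl; trans; sym)
open import Relation.Nullary.Decidable using (Dec; _×-dec_; _⊎-dec_; _→-dec_; ¬?)

module RingOps (R : RawRing 0ℓ 0ℓ) where
  open RawRing R public
  open RawSemiringDefs rawSemiring public using (_^_) renaming (_×_ to _·_)

  infixl 6 _-_
  _-_ : Carrier → Carrier → Carrier
  x - y = x + (- y)

  ∑ ∏ : {A : Set} → List A → (A → Carrier) → Carrier
  ∑ as f = foldr (λ a s → f a + s) 0# as
  ∏ as f = foldr (λ a p → f a * p) 1# as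

module PowerSeries (R : RawRing 0ℓ 0ℓ) where
  open RingOps R

  Series : Set
  Series = ℕ → Carrier

  const : Carrier → Series
  const a zero    = a
  const a (suc _) = 0#

  var : Series
  var 1 = 1#
  var _ = 0#

  ∂ : Series → Series
  ∂ f n = suc n · f (suc n)

  rawRing : RawRing 0ℓ 0ℓ
  rawRing = record
    { Carrier = Series
    ; _≈_     = λ f g → ∀ n → f n ≈ g n
    ; _+_     = λ f g n → f n + g n
    ; _*_     = λ f g n → ∑ (upTo (suc n)) λ i → f i * g (n ∸ i)
    ; -_      = λ f n → - f n
    ; 0#      = λ _ → 0#
    ; 1#      = const 1#
    }

-- ℤ⟦x₁,…,x_k⟧, as iterated power series.
ℤ⟦x⟧ : ℕ → RawRing 0ℓ 0ℓ
ℤ⟦x⟧ zero    = ℤ.+-*-rawRing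
ℤ⟦x⟧ (suc k) = PowerSeries.rawRing (ℤ⟦x⟧ k)

x : ∀ {k} → Fin k → RawRing.Carrier (ℤ⟦x⟧ k)
x {suc k} zero    = PowerSeries.var (ℤ⟦x⟧ k)
x {suc k} (suc i) = PowerSeries.const (ℤ⟦x⟧ k) (x i)

-- A formal power series f in countably many variables x₁, x₂, … is encoded by
-- the family of all its truncations f(x₁,…,x_k,0,0,…), k ∈ ℕ; every monomial
-- involves finitely many variables, so f is determined by this family, and the
-- ring operations commute with truncation.  Thus Sym contains the ring of
-- symmetric functions as a subring; it also contains incompatible families,
-- but these never occur below, since only elements built from the e n and the
-- X H are used, and EPositive f forces f to be a symmetric function.
Sym : RawRing 0ℓ 0ℓ
Sym = record
  { Carrier = ∀ k → Carrier (ℤ⟦x⟧ k)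
  ; _≈_     = λ f g → ∀ k → _≈_ (ℤ⟦x⟧ k) (f k) (g k)
  ; _+_     = λ f g k → _+_ (ℤ⟦x⟧ k) (f k) (g k)
  ; _*_     = λ f g k → _*_ (ℤ⟦x⟧ k) (f k) (g k)
  ; -_      = λ f k → -_ (ℤ⟦x⟧ k) (f k)
  ; 0#      = λ k → 0# (ℤ⟦x⟧ k)
  ; 1#      = λ k → 1# (ℤ⟦x⟧ k)
  } where open RawRing

words : {A : Set} → List A → ∀ n → List (Vec A n)
words as zero    = [ [] ]
words as (suc n) = cartesianProductWith _∷_ as (words as n)

subsets : ∀ k → List (Subset k)
subsets = words (true ∷ false ∷ [])

e : ℕ → RawRing.Carrier Sym
e n k = ∑ (filter (λ S → ∣ S ∣ ℕₚ.≟ n) (subsets k)) λ S →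
        ∏ (filter (_∈? S) (allFin k)) x
  where open RingOps (ℤ⟦x⟧ k)

record Partition : Set where
  field
    parts      : List ℕ
    positive   : All ℕ.NonZero parts
    decreasing : Linked _≥_ parts

eλ : Partition → RawRing.Carrier Sym
eλ p = ∏ (Partition.parts p) e
  where open RingOps Sym

-- f is a finite combination of the e_λ with coefficients in ℕ.  As the e_λ are
-- linearly independent, this says that the expansion of f in this basis has
-- nonnegative coefficients.
EPositiveSym : RawRing.Carrier Sym → Set
EPositiveSym f =
  Σ[ cs ∈ List (ℕ × Partition) ] f ≈ ∑ cs λ { (c , p) → c · eλ p }
  where open RingOps Sym

record Graph : Set₁ where
  field
    order  : ℕ
    Adj    : Rel (Fin order) 0ℓ
    adj?   : Decidable Adj
    symm   : Symmetric Adj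
    irrefl : Irreflexive _≡_ Adj

module _ (H : Graph) where
  open Graph H

  Proper : ∀ {k} → Vec (Fin k) order → Set
  Proper κ = ∀ u v → Adj u v → lookup κ u ≢ lookup κ v

  proper? : ∀ {k} (κ : Vec (Fin k) order) → Dec (Proper κ)
  proper? κ = all? λ u → all? λ v →
    adj? u v →-dec ¬? (lookup κ u ≟ᶠ lookup κ v)

  -- Setting x_{k+1} = x_{k+2} = … = 0 leaves the colorings with colors 1,…,k.
  X : RawRing.Carrier Sym
  X k = ∑ (filter proper? (words (allFin k) order)) λ κ →
        ∏ (allFin order) λ u → x (lookup κ u)
    where open RingOps (ℤ⟦x⟧ k)

Next : ∀ {n} → Rel (Fin n) 0ℓ
Next u v = toℕ v ≡ suc (toℕ u)

next? : ∀ {n} → Decidable (Next {n})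
next? u v = toℕ v ℕₚ.≟ suc (toℕ u)

P : ℕ → Graph
P n = record
  { order  = n
  ; Adj    = λ u v → Next u v ⊎ Next v u
  ; adj?   = λ u v → next? u v ⊎-dec next? v u
  ; symm   = swap
  ; irrefl = λ { refl (inj₁ q) → ℕₚ.1+n≢n (sym q)
               ; refl (inj₂ q) → ℕₚ.1+n≢n (sym q) }
  }

-- C m is the cycle on m + 3 vertices: the edges {i, i + 1} and {0, m + 2}.
C : ℕ → Graph
C m = record
  { order  = n
  ; Adj    = λ u v → Arc u v ⊎ Arc v u
  ; adj?   = λ u v → arc? u v ⊎-dec arc? v u
  ; symm   = swap
  ; irrefl = λ { refl (inj₁ a) → loopless a ; refl (inj₂ a) → loopless a }
  }
  where
  open import Data.Empty using (⊥)

  n : ℕ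
  n = 3 ℕ.+ m

  Arc : Rel (Fin n) 0ℓ
  Arc u v = Next u v ⊎ (toℕ u ≡ 2 ℕ.+ m × toℕ v ≡ 0)

  arc? : Decidable Arc
  arc? u v = next? u v ⊎-dec ((toℕ u ℕₚ.≟ 2 ℕ.+ m) ×-dec (toℕ v ℕₚ.≟ 0))

  loopless : ∀ {u} → Arc u u → ⊥
  loopless (inj₁ q)       = ℕₚ.1+n≢n (sym q)
  loopless (inj₂ (p , q)) with () ← trans (sym p) q

Sym⟦z⟧ : RawRing 0ℓ 0ℓ
Sym⟦z⟧ = PowerSeries.rawRing Sym

open RingOps Sym⟦z⟧ public using (_≈_; _+_; _*_; -_; _-_; _·_; _^_; 0#; 1#)
open PowerSeries Sym public using (∂; const) renaming (Series to ZSeries; var to z)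

EPositive : ZSeries → Set
EPositive f = ∀ n → EPositiveSym (f n)

E : ZSeries
E n = e n

D : ZSeries
D = E - z * ∂ E

-- X (P 0) is the empty product 1.
𝒳P : ZSeries
𝒳P n = X (P n)

𝒳C : ZSeries
𝒳C 0 = RawRing.0# Sym
𝒳C 1 = RawRing.0# Sym
𝒳C 2 = RingOps._·_ Sym 2 (e 2)
𝒳C (suc (suc (suc m))) = X (C m)

-- F = N / G in the ring of power series; a series with constant term 1 is a
-- unit, so the quotient makes sense and equals F exactly when F * G = N.
_≈_/_ : ZSeries → ZSeries → ZSeries → Set
F ≈ N / G = RawRing._≈_ Sym (G 0) (RawRing.1# Sym) × (F * G ≈ N)

-- "F is a rational function with e-positive numerator", the denominator being
-- the common denominator D of 𝒳P and 𝒳C.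
HasEPositiveNumerator : ZSeries → Set
HasEPositiveNumerator F = Σ[ N ∈ ZSeries ] (EPositive N × (F ≈ N / D))

{-# OPTIONS --safe #-}
module Submission where

-- Part (a) is read off coefficientwise: each expression is ∑ α(n) eₙ zⁿ for an
-- explicit α : ℕ → ℕ.  For part (b), clear denominators with Stanley's formulas
-- 𝒳P D = E and 𝒳C D = z² E″; with c = e₁ z the numerators become
--   (zE′ − c) + c (zE′ − E + 1)  and  (z²E″ − zE′ + c) + c (z²E″ − zE′ − 1 + E).
--
-- Stanley's formulas are proved in k variables by a transfer-matrix argument.
-- Let E_a be E without the factor L_a = 1 + x_a z, so that E = L_a E_a and
-- E′ = ∑ x_a E_a.  For a set t of letters let H_a count the continuations of the
-- letter a to a proper word ending in t, and put U = ∑ x_a z H_a.  Then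
-- L_a H_a = [a ∈ t] + U, whence U D = ∑_{a ∈ t} x_a z E_a.  Paths are the case of
-- all letters, 𝒳P = 1 + U.  For cycles let t be the complement of b: then
-- L_b H_b D = U D = zE′ − x_b z E_b = L_b z E_b′, so H_b D = z E_b′, and summing
-- x_b z H_b over b gives 𝒳C D = z² (∑ x_b E_b)′ = z² E″.

open import Level using (0ℓ)
open import Algebra.Bundles using (CommutativeRing)
open import Algebra.Bundles.Raw using (RawRing)
open import Algebra.Structures using (IsCommutativeRing)
open import Data.Bool.Base using (Bool; true; false; if_then_else_; not; _∧_; T)
open import Data.Bool.Properties using (T-∧; ∧-assoc)
open import Data.Empty using (⊥-elim)
open import Data.Fin.Base using (Fin; zero; suc; toℕ; fromℕ)
open import Data.Fin.Properties using (toℕ-fromℕ; toℕ-injective) renaming (_≟_ to _≟ᶠ_)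
open import Data.Fin.Subset using (∣_∣)
open import Data.Fin.Subset.Properties using (_∈?_)
open import Data.Integer.Properties using () renaming (+-*-isCommutativeRing to ℤ-isCommutativeRing)
open import Data.List.Base using (List; []; _∷_; _++_; map; filter; tabulate; allFin; applyUpTo; upTo; cartesianProductWith)
open import Data.List.Relation.Unary.All using ([]; _∷_)
open import Data.List.Relation.Unary.Linked using ([]; [-]; _∷_)
open import Data.Nat.Base as ℕ using (ℕ; zero; suc; pred; _∸_)
import Data.Nat.Properties as ℕₚ
open import Data.Nat.Tactic.RingSolver using (solve-∀)
open import Data.Product.Base using (_×_; _,_; proj₁; proj₂)
open import Data.Sum.Base using (inj₁; inj₂)
open import Data.Vec.Base using (Vec; []; _∷_; lookup)
open import Function.Base using (_∘_; id)
open import Function.Bundles using (Equivalence)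
open import Relation.Binary.PropositionalEquality as ≡ using (_≡_; _≢_)
open import Relation.Nullary.Decidable using (Dec; yes; no; does; dec-true)
open import Relation.Nullary.Negation using (¬_)
open import Relation.Unary using (Decidable)

open import Defs using (module RingOps; module PowerSeries; ℤ⟦x⟧; Sym; words; subsets; x; X; P; C; Proper; proper?)

-- Commutative rings and power series

IsCommRing : RawRing 0ℓ 0ℓ → Set
IsCommRing R = IsCommutativeRing _≈_ _+_ _*_ -_ 0# 1#
  where open RawRing R

module CommRing {R : RawRing 0ℓ 0ℓ} (isCommRing : IsCommRing R) where
  open RingOps R public
  open IsCommutativeRing isCommRing public hiding (_-_; zero)

  commutativeRing : CommutativeRing 0ℓ 0ℓ
  commutativeRing = record { isCommutativeRing = isCommRing }

  open CommutativeRing commutativeRing public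
    using (ring; semiring; commutativeSemiring; +-commutativeMonoid)
  open import Algebra.Properties.CommutativeMonoid.Mult +-commutativeMonoid public
    using (×-congʳ; ×-congˡ; ×-homo-+; ×-assocˡ; ×-homo-1; ×-distrib-+)
  open import Algebra.Properties.Semiring.Mult semiring public
    using (×-comm-*)
  open import Algebra.Properties.Ring ring public using (-‿distribʳ-*; +-cancelʳ)
  open import Relation.Binary.Reasoning.Setoid setoid public
  open import Algebra.Solver.Ring.NaturalCoefficients.Default commutativeSemiring public
    using (solve; _:=_; _:+_; _:*_; con)

  -- Identities are solved over commutative semirings. These lemmas trade a difference for an added
  -- term, so a negation enters the solver at most as an atom.
  [x+y]-y≈x : ∀ x y → (x + y) - y ≈ x
  [x+y]-y≈x x y = trans (+-assoc x y (- y)) (trans (+-congˡ (-‿inverseʳ y)) (+-identityʳ x))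

  [x-y]+y≈x : ∀ x y → (x - y) + y ≈ x
  [x-y]+y≈x x y = trans (+-assoc x (- y) y) (trans (+-congˡ (-‿inverseˡ y)) (+-identityʳ x))

  x≈z+y⇒x-y≈z : ∀ {x y z} → x ≈ z + y → x - y ≈ z
  x≈z+y⇒x-y≈z {x} {y} {z} x≈z+y = trans (+-congʳ x≈z+y) ([x+y]-y≈x z y)

  *-distribˡ-- : ∀ x y z → x * (y - z) ≈ x * y - x * z
  *-distribˡ-- x y z = trans (distribˡ x y (- z)) (+-congˡ (sym (-‿distribʳ-* x z)))

  [x-y+z]+y≈x+z : ∀ x y z → (x - y + z) + y ≈ x + z
  [x-y+z]+y≈x+z x y z = trans
    (solve 4 (λ x y′ z y → (x :+ y′ :+ z) :+ y := (x :+ z) :+ (y′ :+ y)) refl x (- y) z y)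
    (trans (+-congˡ (-‿inverseˡ y)) (+-identityʳ (x + z)))

  ·-zeroʳ : ∀ n → n · 0# ≈ 0#
  ·-zeroʳ zero    = refl
  ·-zeroʳ (suc n) = trans (+-identityˡ _) (·-zeroʳ n)

  infixr 7 _?*_
  -- Multiplication by an Iverson bracket. It turns a sum over a filtered list into a sum over the
  -- whole list.
  _?*_ : Bool → Carrier → Carrier
  b ?* r = if b then r else 0#

  ?*-cong : ∀ b {r s} → r ≈ s → b ?* r ≈ b ?* s
  ?*-cong true  r≈s = r≈s
  ?*-cong false r≈s = refl

  ?*-* : ∀ b r s → b ?* (r * s) ≈ r * (b ?* s)
  ?*-* true  r s = refl
  ?*-* false r s = sym (zeroʳ r)

  module _ {A : Set} where
    ∑-cong : ∀ (as : List A) {f g} → (∀ a → f a ≈ g a) → ∑ as f ≈ ∑ as g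
    ∑-cong []       f≈g = refl
    ∑-cong (a ∷ as) f≈g = +-cong (f≈g a) (∑-cong as f≈g)

    ∑-zero : ∀ (as : List A) → ∑ as (λ _ → 0#) ≈ 0#
    ∑-zero []       = refl
    ∑-zero (a ∷ as) = trans (+-identityˡ _) (∑-zero as)

    ∑-+ : ∀ (as : List A) f g → ∑ as (λ a → f a + g a) ≈ ∑ as f + ∑ as g
    ∑-+ []       f g = sym (+-identityˡ 0#)
    ∑-+ (a ∷ as) f g = begin
      (f a + g a) + ∑ as (λ a → f a + g a) ≈⟨ +-congˡ (∑-+ as f g) ⟩
      (f a + g a) + (∑ as f + ∑ as g)
        ≈⟨ solve 4 (λ p q r s → (p :+ q) :+ (r :+ s) := (p :+ r) :+ (q :+ s)) refl _ _ _ _ ⟩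
      (f a + ∑ as f) + (g a + ∑ as g) ∎

    *-distribˡ-∑ : ∀ r (as : List A) f → r * ∑ as f ≈ ∑ as (λ a → r * f a)
    *-distribˡ-∑ r []       f = zeroʳ r
    *-distribˡ-∑ r (a ∷ as) f = trans (distribˡ _ _ _) (+-congˡ (*-distribˡ-∑ r as f))

    *-distribʳ-∑ : ∀ r (as : List A) f → ∑ as f * r ≈ ∑ as (λ a → f a * r)
    *-distribʳ-∑ r []       f = zeroˡ r
    *-distribʳ-∑ r (a ∷ as) f = trans (distribʳ _ _ _) (+-congˡ (*-distribʳ-∑ r as f))

    ·-distrib-∑ : ∀ n (as : List A) f → n · ∑ as f ≈ ∑ as (λ a → n · f a)
    ·-distrib-∑ n []       f = ·-zeroʳ n
    ·-distrib-∑ n (a ∷ as) f = trans (×-distrib-+ _ _ n) (+-congˡ (·-distrib-∑ n as f))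

    ∑-++ : ∀ (as bs : List A) f → ∑ (as ++ bs) f ≈ ∑ as f + ∑ bs f
    ∑-++ []       bs f = sym (+-identityˡ _)
    ∑-++ (a ∷ as) bs f = trans (+-congˡ (∑-++ as bs f)) (sym (+-assoc _ _ _))

    ∑-filter : ∀ {P : A → Set} (P? : Decidable P) as f → ∑ (filter P? as) f ≈ ∑ as (λ a → does (P? a) ?* f a)
    ∑-filter P? []       f = refl
    ∑-filter P? (a ∷ as) f with does (P? a)
    ... | true  = +-congˡ (∑-filter P? as f)
    ... | false = trans (∑-filter P? as f) (sym (+-identityˡ _))

    ∏-filter : ∀ {P : A → Set} (P? : Decidable P) as f → ∏ (filter P? as) f ≈ ∏ as (λ a → if does (P? a) then f a else 1#)
    ∏-filter P? []       f = refl
    ∏-filter P? (a ∷ as) f with does (P? a)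
    ... | true  = *-congˡ (∏-filter P? as f)
    ... | false = trans (∏-filter P? as f) (sym (*-identityˡ _))

  module _ {A B : Set} where
    ∑-map : ∀ (h : A → B) as f → ∑ (map h as) f ≡ ∑ as (f ∘ h)
    ∑-map h []       f = ≡.refl
    ∑-map h (a ∷ as) f = ≡.cong (f (h a) +_) (∑-map h as f)

    -- Stated for general `g`, because the induction passes from `g` to `g ∘ suc`; it is used at
    -- `id`.
    ∑-tabulate : ∀ (h : A → B) {n} (g : Fin n → A) f → ∑ (tabulate (h ∘ g)) f ≡ ∑ (tabulate g) (f ∘ h)
    ∑-tabulate h {zero}  g f = ≡.refl
    ∑-tabulate h {suc n} g f = ≡.cong (f (h (g zero)) +_) (∑-tabulate h (g ∘ suc) f)

    ∏-tabulate : ∀ (h : A → B) {n} (g : Fin n → A) f → ∏ (tabulate (h ∘ g)) f ≡ ∏ (tabulate g) (f ∘ h)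
    ∏-tabulate h {zero}  g f = ≡.refl
    ∏-tabulate h {suc n} g f = ≡.cong (f (h (g zero)) *_) (∏-tabulate h (g ∘ suc) f)

  ∑-applyUpTo : ∀ {A B : Set} (h : A → B) g n f → ∑ (applyUpTo (h ∘ g) n) f ≡ ∑ (applyUpTo g n) (f ∘ h)
  ∑-applyUpTo h g zero    f = ≡.refl
  ∑-applyUpTo h g (suc n) f = ≡.cong (f (h (g zero)) +_) (∑-applyUpTo h (g ∘ suc) n f)

  ∑-allFin : ∀ {k} (f : Fin (suc k) → Carrier) → ∑ (allFin (suc k)) f ≡ f zero + ∑ (allFin k) (f ∘ suc)
  ∑-allFin f = ≡.cong (f zero +_) (∑-tabulate suc id f)

  ∏-allFin : ∀ {k} (f : Fin (suc k) → Carrier) → ∏ (allFin (suc k)) f ≡ f zero * ∏ (allFin k) (f ∘ suc)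
  ∏-allFin f = ≡.cong (f zero *_) (∏-tabulate suc id f)

  ∏-cong : ∀ {A : Set} (as : List A) {f g} → (∀ a → f a ≈ g a) → ∏ as f ≈ ∏ as g
  ∏-cong []       f≈g = refl
  ∏-cong (a ∷ as) f≈g = *-cong (f≈g a) (∏-cong as f≈g)

  ∑-cartesianProductWith : ∀ {A B C : Set} (h : A → B → C) as bs f →
    ∑ (cartesianProductWith h as bs) f ≈ ∑ as (λ a → ∑ bs (λ b → f (h a b)))
  ∑-cartesianProductWith h []       bs f = refl
  ∑-cartesianProductWith h (a ∷ as) bs f = trans (∑-++ (map (h a) bs) _ f)
    (+-cong (reflexive (∑-map (h a) bs f)) (∑-cartesianProductWith h as bs f))

  -- The omitted term is added back instead of being subtracted on the right. This is how the ban on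
  -- one letter is lifted in `linear-walks` and `arrivals-avoid-𝔻`.
  ∑-≢ : ∀ {k} (b : Fin k) f →
    ∑ (allFin k) (λ a → not (does (b ≟ᶠ a)) ?* f a) + f b ≈ ∑ (allFin k) f
  ∑-≢ {suc k} zero f = begin
    ∑ (allFin (suc k)) (λ a → not (does (zero ≟ᶠ a)) ?* f a) + f zero ≡⟨ ≡.cong (_+ f zero) (∑-allFin {k} _) ⟩
    (0# + ∑ (allFin k) (f ∘ suc)) + f zero ≈⟨ solve 2 (λ p q → (con 0 :+ p) :+ q := q :+ p) refl _ _ ⟩
    f zero + ∑ (allFin k) (f ∘ suc) ≡⟨ ∑-allFin f ⟨
    ∑ (allFin (suc k)) f ∎
  ∑-≢ {suc k} (suc b) f = begin
    ∑ (allFin (suc k)) (λ a → not (does (suc b ≟ᶠ a)) ?* f a) + f (suc b) ≡⟨ ≡.cong (_+ f (suc b)) (∑-allFin {k} _) ⟩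
    (f zero + ∑ (allFin k) (λ a → not (does (b ≟ᶠ a)) ?* f (suc a))) + f (suc b) ≈⟨ +-assoc _ _ _ ⟩
    f zero + (∑ (allFin k) (λ a → not (does (b ≟ᶠ a)) ?* f (suc a)) + f (suc b)) ≈⟨ +-congˡ (∑-≢ b (f ∘ suc)) ⟩
    f zero + ∑ (allFin k) (f ∘ suc) ≡⟨ ∑-allFin f ⟨
    ∑ (allFin (suc k)) f ∎

module SeriesRing {R : RawRing 0ℓ 0ℓ} (cr : IsCommRing R) where
  open CommRing cr
  open PowerSeries R using (Series; const; var; ∂; rawRing)
  module S = RingOps rawRing

  tail : Series → Series
  tail f n = f (suc n)

  scale : Carrier → Series → Series
  scale r f n = r * f n

  *-zero : ∀ f g → (f S.* g) 0 ≈ f 0 * g 0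
  *-zero f g = +-identityʳ _

  -- Convolution obeys f g = f₀ g + z (tail f) g. The ring laws follow from this recursion by
  -- induction on the degree, without reindexing double sums.
  *-suc : ∀ f g n → (f S.* g) (suc n) ≡ f 0 * g (suc n) + (tail f S.* g) n
  *-suc f g n = ≡.cong (f 0 * g (suc n) +_) (∑-applyUpTo suc id (suc n) _)

  S*-cong : ∀ {f f′ g g′} → f S.≈ f′ → g S.≈ g′ → f S.* g S.≈ f′ S.* g′
  S*-cong f≈f′ g≈g′ n = ∑-cong (upTo (suc n)) λ i → *-cong (f≈f′ i) (g≈g′ (n ∸ i))

  S*-distribʳ : ∀ f g h → (g S.+ h) S.* f S.≈ g S.* f S.+ h S.* f
  S*-distribʳ f g h n = trans (∑-cong (upTo (suc n)) λ i → distribʳ _ _ _) (∑-+ (upTo (suc n)) _ _)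

  scale-* : ∀ r f g → scale r f S.* g S.≈ scale r (f S.* g)
  scale-* r f g n = trans (∑-cong (upTo (suc n)) λ i → *-assoc _ _ _) (sym (*-distribˡ-∑ r (upTo (suc n)) _))

  -- The heads of both factors are peeled off in turn, leaving the product of the two tails two
  -- degrees lower; hence two base cases.
  S*-comm : ∀ f g → f S.* g S.≈ g S.* f
  S*-comm f g zero = trans (*-zero f g) (trans (*-comm _ _) (sym (*-zero g f)))
  S*-comm f g (suc zero) = begin
    (f S.* g) 1                        ≡⟨ *-suc f g 0 ⟩
    f 0 * g 1 + (tail f S.* g) 0       ≈⟨ +-congˡ (*-zero (tail f) g) ⟩
    f 0 * g 1 + f 1 * g 0              ≈⟨ solve 4 (λ p q r s → p :* q :+ r :* s := s :* r :+ q :* p) refl _ _ _ _ ⟩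
    g 0 * f 1 + g 1 * f 0              ≈⟨ +-congˡ (*-zero (tail g) f) ⟨
    g 0 * f 1 + (tail g S.* f) 0       ≡⟨ *-suc g f 0 ⟨
    (g S.* f) 1                        ∎
  S*-comm f g (suc (suc n)) = begin
    (f S.* g) (2 ℕ.+ n) ≡⟨ *-suc f g (suc n) ⟩
    f 0 * g (2 ℕ.+ n) + (tail f S.* g) (suc n) ≈⟨ +-congˡ (S*-comm (tail f) g (suc n)) ⟩
    f 0 * g (2 ℕ.+ n) + (g S.* tail f) (suc n) ≡⟨ ≡.cong (f 0 * g (2 ℕ.+ n) +_) (*-suc g (tail f) n) ⟩
    f 0 * g (2 ℕ.+ n) + (g 0 * f (2 ℕ.+ n) + (tail g S.* tail f) n) ≈⟨ +-congˡ (+-congˡ (S*-comm (tail g) (tail f) n)) ⟩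
    f 0 * g (2 ℕ.+ n) + (g 0 * f (2 ℕ.+ n) + (tail f S.* tail g) n)
      ≈⟨ solve 3 (λ p q r → p :+ (q :+ r) := q :+ (p :+ r)) refl _ _ _ ⟩
    g 0 * f (2 ℕ.+ n) + (f 0 * g (2 ℕ.+ n) + (tail f S.* tail g) n) ≡⟨ ≡.cong (g 0 * f (2 ℕ.+ n) +_) (*-suc f (tail g) n) ⟨
    g 0 * f (2 ℕ.+ n) + (f S.* tail g) (suc n) ≈⟨ +-congˡ (S*-comm f (tail g) (suc n)) ⟩
    g 0 * f (2 ℕ.+ n) + (tail g S.* f) (suc n) ≡⟨ *-suc g f (suc n) ⟨
    (g S.* f) (2 ℕ.+ n) ∎

  tail-* : ∀ f g → tail (f S.* g) S.≈ scale (f 0) (tail g) S.+ tail f S.* g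
  tail-* f g n = reflexive (*-suc f g n)

  -- Since tail (f g) = f₀ (tail g) + (tail f) g, degree n + 1 reduces to the law for `tail f`, `g`,
  -- `h` in degree n.
  S*-assoc : ∀ f g h → (f S.* g) S.* h S.≈ f S.* (g S.* h)
  S*-assoc f g h zero = begin
    ((f S.* g) S.* h) 0   ≈⟨ *-zero (f S.* g) h ⟩
    (f S.* g) 0 * h 0     ≈⟨ *-congʳ (*-zero f g) ⟩
    f 0 * g 0 * h 0       ≈⟨ *-assoc _ _ _ ⟩
    f 0 * (g 0 * h 0)     ≈⟨ *-congˡ (*-zero g h) ⟨
    f 0 * (g S.* h) 0     ≈⟨ *-zero f (g S.* h) ⟨
    (f S.* (g S.* h)) 0   ∎
  S*-assoc f g h (suc n) = begin
    ((f S.* g) S.* h) (suc n) ≡⟨ *-suc (f S.* g) h n ⟩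
    (f S.* g) 0 * h (suc n) + (tail (f S.* g) S.* h) n
      ≈⟨ +-cong (*-congʳ (*-zero f g)) (S*-cong {g = h} (tail-* f g) (λ _ → refl) n) ⟩
    f 0 * g 0 * h (suc n) + ((scale (f 0) (tail g) S.+ tail f S.* g) S.* h) n
      ≈⟨ +-congˡ (S*-distribʳ h (scale (f 0) (tail g)) (tail f S.* g) n) ⟩
    f 0 * g 0 * h (suc n) + ((scale (f 0) (tail g) S.* h) n + ((tail f S.* g) S.* h) n)
      ≈⟨ +-congˡ (+-cong (scale-* (f 0) (tail g) h n) (S*-assoc (tail f) g h n)) ⟩
    f 0 * g 0 * h (suc n) + (f 0 * (tail g S.* h) n + (tail f S.* (g S.* h)) n)
      ≈⟨ solve 5 (λ p q r s t → p :* q :* r :+ (p :* s :+ t) := p :* (q :* r :+ s) :+ t) refl _ _ _ _ _ ⟩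
    f 0 * (g 0 * h (suc n) + (tail g S.* h) n) + (tail f S.* (g S.* h)) n
      ≡⟨ ≡.cong (λ s → f 0 * s + (tail f S.* (g S.* h)) n) (*-suc g h n) ⟨
    f 0 * (g S.* h) (suc n) + (tail f S.* (g S.* h)) n ≡⟨ *-suc f (g S.* h) n ⟨
    (f S.* (g S.* h)) (suc n) ∎

  0*-zero : ∀ f → S.0# S.* f S.≈ S.0#
  0*-zero f n = trans (∑-cong (upTo (suc n)) λ i → zeroˡ _) (∑-zero (upTo (suc n)))

  const-* : ∀ r f n → (const r S.* f) n ≈ r * f n
  const-* r f zero    = *-zero (const r) f
  const-* r f (suc n) = begin
    (const r S.* f) (suc n)             ≡⟨ *-suc (const r) f n ⟩
    r * f (suc n) + (S.0# S.* f) n      ≈⟨ +-congˡ (0*-zero f n) ⟩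
    r * f (suc n) + 0#                  ≈⟨ +-identityʳ _ ⟩
    r * f (suc n)                       ∎

  1*-identity : ∀ f → S.1# S.* f S.≈ f
  1*-identity f n = trans (const-* 1# f n) (*-identityˡ _)

  isCommRing : IsCommRing rawRing
  isCommRing = record
    { isRing = record
      { +-isAbelianGroup = record
        { isGroup = record
          { isMonoid = record
            { isSemigroup = record
              { isMagma = record
                { isEquivalence = record
                  { refl = λ _ → refl
                  ; sym = λ p n → sym (p n)
                  ; trans = λ p q n → trans (p n) (q n)
                  }
                ; ∙-cong = λ p q n → +-cong (p n) (q n)
                }
              ; assoc = λ f g h n → +-assoc _ _ _
              }
            ; identity = (λ f n → +-identityˡ _) , λ f n → +-identityʳ _
            }
          ; inverse = (λ f n → -‿inverseˡ _) , λ f n → -‿inverseʳ _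
          ; ⁻¹-cong = λ p n → -‿cong (p n)
          }
        ; comm = λ f g n → +-comm _ _
        }
      ; *-cong = S*-cong
      ; *-assoc = S*-assoc
      ; *-identity = 1*-identity , λ f n → trans (S*-comm f S.1# n) (1*-identity f n)
      ; distrib = (λ f g h n → trans (S*-comm f (g S.+ h) n) (trans (S*-distribʳ f g h n)
                     (+-cong (S*-comm g f n) (S*-comm h f n))))
                , S*-distribʳ
      }
    ; *-comm = S*-comm
    }

  var-*-zero : ∀ f → (var S.* f) 0 ≈ 0#
  var-*-zero f = trans (*-zero var f) (zeroˡ _)

  var-*-suc : ∀ f n → (var S.* f) (suc n) ≈ f n
  var-*-suc f n = begin
    (var S.* f) (suc n)                    ≡⟨ *-suc var f n ⟩
    0# * f (suc n) + (tail var S.* f) n    ≈⟨ +-cong (zeroˡ _) (S*-cong {g = f} tail-var (λ _ → refl) n) ⟩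
    0# + (S.1# S.* f) n                    ≈⟨ +-identityˡ _ ⟩
    (S.1# S.* f) n                         ≈⟨ 1*-identity f n ⟩
    f n                                    ∎
    where
    tail-var : tail var S.≈ S.1#
    tail-var zero    = refl
    tail-var (suc _) = refl

  ∑-coeff : ∀ {A : Set} (as : List A) F n → S.∑ as F n ≡ ∑ as (λ a → F a n)
  ∑-coeff []       F n = ≡.refl
  ∑-coeff (a ∷ as) F n = ≡.cong (F a n +_) (∑-coeff as F n)

  ·-coeff : ∀ m f n → (m S.· f) n ≡ m · f n
  ·-coeff zero    f n = ≡.refl
  ·-coeff (suc m) f n = ≡.cong (f n +_) (·-coeff m f n)

  ∂-cong : ∀ {f g} → f S.≈ g → ∂ f S.≈ ∂ g
  ∂-cong f≈g n = ×-congʳ (suc n) (f≈g (suc n))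

  ∂-+ : ∀ f g → ∂ (f S.+ g) S.≈ ∂ f S.+ ∂ g
  ∂-+ f g n = ×-distrib-+ _ _ (suc n)

  ∂-const-* : ∀ r f → ∂ (const r S.* f) S.≈ const r S.* ∂ f
  ∂-const-* r f n = begin
    suc n · (const r S.* f) (suc n)  ≈⟨ ×-congʳ (suc n) (const-* r f (suc n)) ⟩
    suc n · (r * f (suc n))          ≈⟨ ×-comm-* (suc n) r _ ⟨
    r * (suc n · f (suc n))          ≈⟨ const-* r (∂ f) n ⟨
    (const r S.* ∂ f) n              ∎

  ∂-var-* : ∀ f → ∂ (var S.* f) S.≈ f S.+ var S.* ∂ f
  ∂-var-* f zero = +-cong (var-*-suc f 0) (sym (var-*-zero (∂ f)))
  ∂-var-* f (suc n) = +-cong (var-*-suc f (suc n))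
    (trans (×-congʳ (suc n) (var-*-suc f (suc n))) (sym (var-*-suc (∂ f) n)))

  ∂-∑ : ∀ {A : Set} (as : List A) F → ∂ (S.∑ as F) S.≈ S.∑ as (∂ ∘ F)
  ∂-∑ as F n = begin
    suc n · S.∑ as F (suc n)                ≡⟨ ≡.cong (suc n ·_) (∑-coeff as F (suc n)) ⟩
    suc n · ∑ as (λ a → F a (suc n))        ≈⟨ ·-distrib-∑ (suc n) as _ ⟩
    ∑ as (λ a → suc n · F a (suc n))        ≡⟨ ∑-coeff as (∂ ∘ F) n ⟨
    S.∑ as (∂ ∘ F) n                        ∎

ℤ⟦x⟧-isCommRing : ∀ k → IsCommRing (ℤ⟦x⟧ k)
ℤ⟦x⟧-isCommRing zero    = ℤ-isCommutativeRing
ℤ⟦x⟧-isCommRing (suc k) = SeriesRing.isCommRing (ℤ⟦x⟧-isCommRing k)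

-- Elementary symmetric functions

module Linear {R : RawRing 0ℓ 0ℓ} (cr : IsCommRing R) where
  private module B = CommRing cr
  open SeriesRing cr
  open PowerSeries R
  open CommRing isCommRing

  -- The factor 1 + r z, which is L_a for r = x_a.
  linear : B.Carrier → Series
  linear r = 1# + const r * var

  linear-* : ∀ r f → linear r * f ≈ f + const r * (var * f)
  linear-* r f = solve 3 (λ c v f → (con 1 :+ c :* v) :* f := f :+ c :* (v :* f)) refl _ _ _

  linear-*-zero : ∀ r f → (linear r * f) 0 B.≈ f 0
  linear-*-zero r f = B.begin
    (linear r * f) 0                     B.≈⟨ linear-* r f 0 ⟩
    f 0 B.+ (const r * (var * f)) 0      B.≈⟨ B.+-congˡ (const-* r (var * f) 0) ⟩
    f 0 B.+ r B.* (var * f) 0            B.≈⟨ B.+-congˡ (B.*-congˡ (var-*-zero f)) ⟩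
    f 0 B.+ r B.* B.0#                   B.≈⟨ B.+-congˡ (B.zeroʳ r) ⟩
    f 0 B.+ B.0#                         B.≈⟨ B.+-identityʳ _ ⟩
    f 0                                  B.∎

  linear-*-suc : ∀ r f n → (linear r * f) (suc n) B.≈ f (suc n) B.+ r B.* f n
  linear-*-suc r f n = B.begin
    (linear r * f) (suc n)                        B.≈⟨ linear-* r f (suc n) ⟩
    f (suc n) B.+ (const r * (var * f)) (suc n)   B.≈⟨ B.+-congˡ (const-* r (var * f) (suc n)) ⟩
    f (suc n) B.+ r B.* (var * f) (suc n)         B.≈⟨ B.+-congˡ (B.*-congˡ (var-*-suc f n)) ⟩
    f (suc n) B.+ r B.* f n                       B.∎

  -- As 1 + r z has constant term 1, the product determines the coefficients of the other factor one
  -- after another. This takes the place of dividing by L_a.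
  linear-*-cancel : ∀ r f g → linear r * f ≈ linear r * g → f ≈ g
  linear-*-cancel r f g eq zero =
    B.trans (B.sym (linear-*-zero r f)) (B.trans (eq 0) (linear-*-zero r g))
  linear-*-cancel r f g eq (suc n) = B.+-cancelʳ (r B.* f n) _ _ (B.begin
    f (suc n) B.+ r B.* f n   B.≈⟨ linear-*-suc r f n ⟨
    (linear r * f) (suc n)    B.≈⟨ eq (suc n) ⟩
    (linear r * g) (suc n)    B.≈⟨ linear-*-suc r g n ⟩
    g (suc n) B.+ r B.* g n   B.≈⟨ B.+-congˡ (B.*-congˡ (linear-*-cancel r f g eq n)) ⟨
    g (suc n) B.+ r B.* f n   B.∎)

  ∂-linear-* : ∀ r f → ∂ (linear r * f) ≈ const r * f + linear r * ∂ f
  ∂-linear-* r f = begin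
    ∂ (linear r * f)                          ≈⟨ ∂-cong (linear-* r f) ⟩
    ∂ (f + const r * (var * f))               ≈⟨ ∂-+ f (const r * (var * f)) ⟩
    ∂ f + ∂ (const r * (var * f))             ≈⟨ +-congˡ {∂ f} (∂-const-* r (var * f)) ⟩
    ∂ f + const r * ∂ (var * f)               ≈⟨ +-congˡ {∂ f} (*-congˡ {const r} (∂-var-* f)) ⟩
    ∂ f + const r * (f + var * ∂ f)
      ≈⟨ solve 4 (λ c v f d → d :+ c :* (f :+ v :* d) := c :* f :+ (con 1 :+ c :* v) :* d) refl _ _ _ _ ⟩
    const r * f + linear r * ∂ f              ∎

module Elementary {R : RawRing 0ℓ 0ℓ} (cr : IsCommRing R) where
  private module B = CommRing cr
  open SeriesRing cr
  open Linear cr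
  open PowerSeries R
  open CommRing isCommRing

  elem : ∀ {k} → (Fin k → B.Carrier) → Series
  elem {k} y n = B.∑ (filter (λ S → ∣ S ∣ ℕₚ.≟ n) (subsets k)) λ S →
                 B.∏ (filter (_∈? S) (allFin k)) y

  private
    term : ∀ {k} → (Fin k → B.Carrier) → ℕ → Vec Bool k → B.Carrier
    term {k} y n S = does (∣ S ∣ ℕₚ.≟ n) B.?* B.∏ (allFin k) λ i → if does (i ∈? S) then y i else B.1#

    elem-term : ∀ {k} (y : Fin k → B.Carrier) n → elem y n B.≈ B.∑ (subsets k) (term y n)
    elem-term {k} y n = B.trans (B.∑-filter (λ S → ∣ S ∣ ℕₚ.≟ n) (subsets k) _)
      (B.∑-cong (subsets k) λ S → B.?*-cong (does (∣ S ∣ ℕₚ.≟ n)) (B.∏-filter (_∈? S) (allFin k) y))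

    ∑-term : ∀ {k} (y : Fin (suc k) → B.Carrier) n → B.∑ (subsets (suc k)) (term y n) B.≈
      B.∑ (subsets k) (term y n ∘ (true ∷_)) B.+ B.∑ (subsets k) (term y n ∘ (false ∷_))
    ∑-term {k} y n = B.trans (B.∑-cartesianProductWith _∷_ (true ∷ false ∷ []) (subsets k) (term y n))
      (B.+-congˡ (B.+-identityʳ _))

    term-false : ∀ {k} (y : Fin (suc k) → B.Carrier) n S → term y n (false ∷ S) B.≈ term (y ∘ suc) n S
    term-false {k} y n S = B.?*-cong (does (∣ S ∣ ℕₚ.≟ n))
      (B.trans (B.reflexive (B.∏-allFin {k} _)) (B.*-identityˡ _))

    term-true : ∀ {k} (y : Fin (suc k) → B.Carrier) n S →
      term y (suc n) (true ∷ S) B.≈ y zero B.* term (y ∘ suc) n S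
    term-true {k} y n S = B.trans
      (B.?*-cong (does (∣ S ∣ ℕₚ.≟ n)) (B.reflexive (B.∏-allFin {k} _)))
      (B.?*-* (does (∣ S ∣ ℕₚ.≟ n)) _ _)

  elem-empty : ∀ (y : Fin 0 → B.Carrier) → elem y ≈ 1#
  elem-empty y zero    = B.+-identityʳ _
  elem-empty y (suc n) = B.refl

  -- One factor of E = ∏ (1 + y_i z): subsets are split by whether they contain the first index, and
  -- those that do contribute `y zero` times a subset of size one less.
  elem-suc : ∀ {k} (y : Fin (suc k) → B.Carrier) → elem y ≈ linear (y zero) * elem (y ∘ suc)
  elem-suc {k} y zero = B.begin
    elem y 0                                      B.≈⟨ B.trans (elem-term y 0) (∑-term y 0) ⟩
    -- A subset containing the first index has positive size, so its bracket is false.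
    B.∑ (subsets k) (λ _ → B.0#) B.+ B.∑ (subsets k) (term y 0 ∘ (false ∷_))
      B.≈⟨ B.+-cong (B.∑-zero (subsets k)) (B.∑-cong (subsets k) (term-false y 0)) ⟩
    B.0# B.+ B.∑ (subsets k) (term (y ∘ suc) 0)   B.≈⟨ B.+-identityˡ _ ⟩
    B.∑ (subsets k) (term (y ∘ suc) 0)            B.≈⟨ elem-term (y ∘ suc) 0 ⟨
    elem (y ∘ suc) 0                              B.≈⟨ linear-*-zero (y zero) (elem (y ∘ suc)) ⟨
    (linear (y zero) * elem (y ∘ suc)) 0          B.∎
  elem-suc {k} y (suc n) = B.begin
    elem y (suc n)                                B.≈⟨ B.trans (elem-term y (suc n)) (∑-term y (suc n)) ⟩
    B.∑ (subsets k) (term y (suc n) ∘ (true ∷_)) B.+ B.∑ (subsets k) (term y (suc n) ∘ (false ∷_))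
      B.≈⟨ B.+-cong (B.∑-cong (subsets k) (term-true y n)) (B.∑-cong (subsets k) (term-false y (suc n))) ⟩
    B.∑ (subsets k) (λ S → y zero B.* term (y ∘ suc) n S) B.+ B.∑ (subsets k) (term (y ∘ suc) (suc n))
      B.≈⟨ B.+-cong (B.*-distribˡ-∑ (y zero) (subsets k) _) B.refl ⟨
    y zero B.* B.∑ (subsets k) (term (y ∘ suc) n) B.+ B.∑ (subsets k) (term (y ∘ suc) (suc n))
      B.≈⟨ B.+-cong (B.*-congˡ (elem-term (y ∘ suc) n)) (elem-term (y ∘ suc) (suc n)) ⟨
    y zero B.* elem (y ∘ suc) n B.+ elem (y ∘ suc) (suc n)
      B.≈⟨ B.+-comm _ _ ⟩
    elem (y ∘ suc) (suc n) B.+ y zero B.* elem (y ∘ suc) n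
      B.≈⟨ linear-*-suc (y zero) (elem (y ∘ suc)) n ⟨
    (linear (y zero) * elem (y ∘ suc)) (suc n)    B.∎

  elem-zero : ∀ {k} (y : Fin k → B.Carrier) → elem y 0 B.≈ B.1#
  elem-zero {zero}  y = elem-empty y 0
  elem-zero {suc k} y = B.trans (elem-suc y 0)
    (B.trans (linear-*-zero (y zero) (elem (y ∘ suc))) (elem-zero (y ∘ suc)))

  -- The series E_b, built as the product of the other factors so that no division is involved.
  omit : ∀ {k} → (Fin k → B.Carrier) → Fin k → Series
  omit y zero    = elem (y ∘ suc)
  omit y (suc b) = linear (y zero) * omit (y ∘ suc) b

  elem-omit : ∀ {k} (y : Fin k → B.Carrier) b → elem y ≈ linear (y b) * omit y b
  elem-omit y zero    = elem-suc y
  elem-omit y (suc b) = begin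
    elem y                                                        ≈⟨ elem-suc y ⟩
    linear (y zero) * elem (y ∘ suc)                              ≈⟨ *-congˡ {linear (y zero)} (elem-omit (y ∘ suc) b) ⟩
    linear (y zero) * (linear (y (suc b)) * omit (y ∘ suc) b)
      ≈⟨ solve 3 (λ p q r → p :* (q :* r) := q :* (p :* r)) refl (linear (y zero)) (linear (y (suc b))) (omit (y ∘ suc) b) ⟩
    linear (y (suc b)) * (linear (y zero) * omit (y ∘ suc) b)     ∎

  -- The product rule for ∏ (1 + y_b z): differentiating the factor of b leaves y_b times all the
  -- others.
  ∂-elem : ∀ {k} (y : Fin k → B.Carrier) → ∂ (elem y) ≈ ∑ (allFin k) λ b → const (y b) * omit y b
  ∂-elem {zero}  y n = B.trans (∂-cong (elem-empty y) n) (B.·-zeroʳ (suc n))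
  ∂-elem {suc k} y = begin
    ∂ (elem y)                               ≈⟨ ∂-cong (elem-suc y) ⟩
    ∂ (linear (y zero) * elem (y ∘ suc))     ≈⟨ ∂-linear-* (y zero) (elem (y ∘ suc)) ⟩
    head + linear (y zero) * ∂ (elem (y ∘ suc))
      ≈⟨ +-congˡ {head} (*-congˡ {linear (y zero)} (∂-elem (y ∘ suc))) ⟩
    head + linear (y zero) * ∑ (allFin k) (λ b → const (y (suc b)) * omit (y ∘ suc) b)
      ≈⟨ +-congˡ {head} (*-distribˡ-∑ (linear (y zero)) (allFin k) _) ⟩
    head + ∑ (allFin k) (λ b → linear (y zero) * (const (y (suc b)) * omit (y ∘ suc) b))
      ≈⟨ +-congˡ {head} (∑-cong (allFin k) λ b →
           solve 3 (λ p q r → p :* (q :* r) := q :* (p :* r)) refl (linear (y zero)) (const (y (suc b))) (omit (y ∘ suc) b)) ⟩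
    head + ∑ (allFin k) (λ b → const (y (suc b)) * omit y (suc b))
      ≡⟨ ∑-allFin (λ b → const (y b) * omit y b) ⟨
    ∑ (allFin (suc k)) (λ b → const (y b) * omit y b) ∎
    where
    head = const (y zero) * elem (y ∘ suc)

  var-∂-elem : ∀ {k} (y : Fin k → B.Carrier) →
    var * ∂ (elem y) ≈ ∑ (allFin k) λ b → const (y b) * var * omit y b
  var-∂-elem {k} y = begin
    var * ∂ (elem y)                                          ≈⟨ *-congˡ {var} (∂-elem y) ⟩
    var * ∑ (allFin k) (λ b → const (y b) * omit y b)         ≈⟨ *-distribˡ-∑ var (allFin k) _ ⟩
    ∑ (allFin k) (λ b → var * (const (y b) * omit y b))
      ≈⟨ ∑-cong (allFin k) (λ b →
           solve 3 (λ p q r → p :* (q :* r) := q :* p :* r) refl var (const (y b)) (omit y b)) ⟩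
    ∑ (allFin k) (λ b → const (y b) * var * omit y b)         ∎

-- Words without repeated adjacent letters

-- The word w continues the letter a without repeating adjacent letters, and
-- the last letter of a ∷ w satisfies t.
walk : ∀ {k n} → (Fin k → Bool) → Fin k → Vec (Fin k) n → Bool
walk t a []      = t a
walk t a (c ∷ w) = not (does (a ≟ᶠ c)) ∧ walk t c w

module Walks {R : RawRing 0ℓ 0ℓ} (cr : IsCommRing R) {k} (x : Fin k → RawRing.Carrier R) where
  private module B = CommRing cr
  open SeriesRing cr
  open Linear cr
  open PowerSeries R
  open CommRing isCommRing
  open Elementary cr

  weight : ∀ {n} → Vec (Fin k) n → B.Carrier
  weight {n} w = B.∏ (allFin n) (x ∘ lookup w)

  -- The series H_a. The starting letter `a` itself is not weighted.
  walks : (Fin k → Bool) → Fin k → Series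
  walks t a n = B.∑ (words (allFin k) n) λ w → walk t a w B.?* weight w

  -- The nonempty words with distinct adjacent letters whose last letter satisfies t.
  arrivals : (Fin k → Bool) → Series
  arrivals t = ∑ (allFin k) λ c → const (x c) * var * walks t c

  -- Splits off the first letter. The test `f` is arbitrary, so that this serves both for walks and
  -- for proper colorings.
  ∑-words : ∀ n (f : Vec (Fin k) (suc n) → Bool) →
    B.∑ (words (allFin k) (suc n)) (λ w → f w B.?* weight w) B.≈
    B.∑ (allFin k) λ c → x c B.* B.∑ (words (allFin k) n) λ w → f (c ∷ w) B.?* weight w
  ∑-words n f = B.begin
    B.∑ (words (allFin k) (suc n)) (λ w → f w B.?* weight w)
      B.≈⟨ B.∑-cartesianProductWith _∷_ (allFin k) (words (allFin k) n) _ ⟩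
    B.∑ (allFin k) (λ c → B.∑ (words (allFin k) n) λ w → f (c ∷ w) B.?* weight (c ∷ w))
      B.≈⟨ B.∑-cong (allFin k) (λ c → B.trans
             (B.∑-cong (words (allFin k) n) λ w → B.trans
               (B.?*-cong (f (c ∷ w)) (B.reflexive (B.∏-allFin {n} _)))
               (B.?*-* (f (c ∷ w)) (x c) (weight w)))
             (B.sym (B.*-distribˡ-∑ (x c) (words (allFin k) n) _))) ⟩
    B.∑ (allFin k) (λ c → x c B.* B.∑ (words (allFin k) n) λ w → f (c ∷ w) B.?* weight w) B.∎

  ∑-const-var-zero : ∀ (F : Fin k → Series) → ∑ (allFin k) (λ c → const (x c) * var * F c) 0 B.≈ B.0#
  ∑-const-var-zero F = B.begin
    ∑ (allFin k) (λ c → const (x c) * var * F c) 0      B.≡⟨ ∑-coeff (allFin k) _ 0 ⟩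
    B.∑ (allFin k) (λ c → (const (x c) * var * F c) 0)
      B.≈⟨ B.∑-cong (allFin k) (λ c → B.trans (*-assoc (const (x c)) var (F c) 0) (B.trans
             (const-* (x c) (var * F c) 0) (B.trans (B.*-congˡ (var-*-zero (F c))) (B.zeroʳ _)))) ⟩
    B.∑ (allFin k) (λ c → B.0#)                         B.≈⟨ B.∑-zero (allFin k) ⟩
    B.0#                                                B.∎

  ∑-const-var-suc : ∀ (F : Fin k → Series) n →
    ∑ (allFin k) (λ c → const (x c) * var * F c) (suc n) B.≈ B.∑ (allFin k) λ c → x c B.* F c n
  ∑-const-var-suc F n = B.trans (B.reflexive (∑-coeff (allFin k) _ (suc n)))
    (B.∑-cong (allFin k) λ c → B.trans (*-assoc (const (x c)) var (F c) (suc n))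
      (B.trans (const-* (x c) (var * F c) (suc n)) (B.*-congˡ (var-*-suc (F c) n))))

  walks-suc : ∀ t a n → walks t a (suc n) B.≈ B.∑ (allFin k) λ c → not (does (a ≟ᶠ c)) B.?* (x c B.* walks t c n)
  walks-suc t a n = B.trans (∑-words n (walk t a)) (B.∑-cong (allFin k) λ c → step c (not (does (a ≟ᶠ c))))
    where
    -- The comparison of `a` and `c` is generalized to a Boolean; if it is false, every word is
    -- discarded and the sum vanishes.
    step : ∀ c b → x c B.* B.∑ (words (allFin k) n) (λ w → (b ∧ walk t c w) B.?* weight w) B.≈
                   b B.?* (x c B.* walks t c n)
    step c true  = B.refl
    step c false = B.trans (B.*-congˡ (B.∑-zero (words (allFin k) n))) (B.zeroʳ _)

  -- The term x_a z H_a supplies exactly the continuations that repeat `a` at the start, so together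
  -- with H_a the first letter becomes arbitrary. The constant term is the empty continuation, which
  -- ends in `a`.
  linear-walks : ∀ t a → linear (x a) * walks t a ≈ const (t a B.?* B.1#) + arrivals t
  linear-walks t a zero = B.begin
    (linear (x a) * walks t a) 0             B.≈⟨ linear-*-zero (x a) (walks t a) ⟩
    t a B.?* B.1# B.+ B.0#                   B.≈⟨ B.+-congˡ (∑-const-var-zero (walks t)) ⟨
    t a B.?* B.1# B.+ arrivals t 0           B.∎
  linear-walks t a (suc n) = B.begin
    (linear (x a) * walks t a) (suc n)       B.≈⟨ linear-*-suc (x a) (walks t a) n ⟩
    walks t a (suc n) B.+ x a B.* walks t a n
      B.≈⟨ B.+-congʳ (walks-suc t a n) ⟩
    B.∑ (allFin k) (λ c → not (does (a ≟ᶠ c)) B.?* (x c B.* walks t c n)) B.+ x a B.* walks t a n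
      B.≈⟨ B.∑-≢ a (λ c → x c B.* walks t c n) ⟩
    B.∑ (allFin k) (λ c → x c B.* walks t c n) B.≈⟨ ∑-const-var-suc (walks t) n ⟨
    arrivals t (suc n)                         B.≈⟨ B.+-identityˡ _ ⟨
    B.0# B.+ arrivals t (suc n)                B.∎

  𝔼 𝔻 : Series
  𝔼 = elem x
  𝔻 = 𝔼 - var * ∂ 𝔼

  -- Multiplying linear-walks by u a * omit x a, where u a = x_a z, turns its left
  -- side into a summand of arrivals t * 𝔼; then sum over a.
  arrivals-𝔻 : ∀ t → arrivals t * 𝔻 ≈
    ∑ (allFin k) λ a → const (x a) * var * omit x a * const (t a B.?* B.1#)
  arrivals-𝔻 t = begin
    U * 𝔻                      ≈⟨ *-distribˡ-- U 𝔼 (var * ∂ 𝔼) ⟩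
    U * 𝔼 - U * (var * ∂ 𝔼)    ≈⟨ x≈z+y⇒x-y≈z {U * 𝔼} {U * (var * ∂ 𝔼)} U𝔼 ⟩
    ∑ (allFin k) (λ a → u a * omit x a * τ a) ∎
    where
    U = arrivals t
    u τ : Fin k → Series
    u a = const (x a) * var
    τ a = const (t a B.?* B.1#)

    summand : ∀ a → u a * walks t a * 𝔼 ≈ u a * omit x a * τ a + U * (u a * omit x a)
    summand a = begin
      u a * walks t a * 𝔼                                    ≈⟨ *-congˡ {u a * walks t a} (elem-omit x a) ⟩
      u a * walks t a * (linear (x a) * omit x a)
        ≈⟨ solve 4 (λ p q r s → p :* q :* (r :* s) := p :* s :* (r :* q)) refl (u a) (walks t a) (linear (x a)) (omit x a) ⟩
      u a * omit x a * (linear (x a) * walks t a)            ≈⟨ *-congˡ {u a * omit x a} (linear-walks t a) ⟩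
      u a * omit x a * (τ a + U)
        ≈⟨ solve 3 (λ p q r → p :* (q :+ r) := p :* q :+ r :* p) refl (u a * omit x a) (τ a) U ⟩
      u a * omit x a * τ a + U * (u a * omit x a)            ∎

    U𝔼 : U * 𝔼 ≈ ∑ (allFin k) (λ a → u a * omit x a * τ a) + U * (var * ∂ 𝔼)
    U𝔼 = begin
      U * 𝔼                                              ≈⟨ *-distribʳ-∑ 𝔼 (allFin k) _ ⟩
      ∑ (allFin k) (λ a → u a * walks t a * 𝔼)           ≈⟨ ∑-cong (allFin k) summand ⟩
      ∑ (allFin k) (λ a → u a * omit x a * τ a + U * (u a * omit x a))
        ≈⟨ ∑-+ (allFin k) _ _ ⟩
      ∑ (allFin k) (λ a → u a * omit x a * τ a) + ∑ (allFin k) (λ a → U * (u a * omit x a))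
        ≈⟨ +-congˡ {∑ (allFin k) (λ a → u a * omit x a * τ a)} (*-distribˡ-∑ U (allFin k) _) ⟨
      ∑ (allFin k) (λ a → u a * omit x a * τ a) + U * ∑ (allFin k) (λ a → u a * omit x a)
        ≈⟨ +-congˡ {∑ (allFin k) (λ a → u a * omit x a * τ a)} (*-congˡ {U} (var-∂-elem x)) ⟨
      ∑ (allFin k) (λ a → u a * omit x a * τ a) + U * (var * ∂ 𝔼) ∎

  paths-𝔻 : (1# + arrivals (λ _ → true)) * 𝔻 ≈ 𝔼
  paths-𝔻 = begin
    (1# + U) * 𝔻            ≈⟨ distribʳ 𝔻 1# U ⟩
    1# * 𝔻 + U * 𝔻          ≈⟨ +-cong (*-identityˡ 𝔻) (arrivals-𝔻 (λ _ → true)) ⟩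
    𝔻 + ∑ (allFin k) (λ a → const (x a) * var * omit x a * 1#)
      ≈⟨ +-congˡ {𝔻} (∑-cong (allFin k) λ a → *-identityʳ (const (x a) * var * omit x a)) ⟩
    𝔻 + ∑ (allFin k) (λ a → const (x a) * var * omit x a)  ≈⟨ +-congˡ {𝔻} (var-∂-elem x) ⟨
    𝔻 + var * ∂ 𝔼           ≈⟨ [x-y]+y≈x 𝔼 (var * ∂ 𝔼) ⟩
    𝔼                       ∎
    where U = arrivals (λ _ → true)

  avoid : Fin k → Fin k → Bool
  avoid b a = not (does (b ≟ᶠ a))

  -- Banning b as a last letter removes x_b z E_b from zE′. By the product rule for E = L_b E_b,
  -- what remains is L_b z E_b′.
  arrivals-avoid-𝔻 : ∀ b → arrivals (avoid b) * 𝔻 ≈ linear (x b) * (var * ∂ (omit x b))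
  -- The removed term is added to both sides, which completes the restricted sum to zE′.
  arrivals-avoid-𝔻 b = +-cancelʳ (u b * omit x b) _ _ (begin
    arrivals (avoid b) * 𝔻 + u b * omit x b
      ≈⟨ +-congʳ {u b * omit x b} (trans (arrivals-𝔻 (avoid b)) (∑-cong (allFin k) λ a → indicator a (avoid b a))) ⟩
    ∑ (allFin k) (λ a → avoid b a ?* (u a * omit x a)) + u b * omit x b
      ≈⟨ ∑-≢ b (λ a → u a * omit x a) ⟩
    ∑ (allFin k) (λ a → u a * omit x a)             ≈⟨ var-∂-elem x ⟨
    var * ∂ 𝔼                                       ≈⟨ *-congˡ {var} (∂-cong (elem-omit x b)) ⟩
    var * ∂ (linear (x b) * omit x b)               ≈⟨ *-congˡ {var} (∂-linear-* (x b) (omit x b)) ⟩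
    var * (const (x b) * omit x b + linear (x b) * ∂ (omit x b))
      ≈⟨ solve 5 (λ v c o l d → v :* (c :* o :+ l :* d) := l :* (v :* d) :+ c :* v :* o) refl
           var (const (x b)) (omit x b) (linear (x b)) (∂ (omit x b)) ⟩
    linear (x b) * (var * ∂ (omit x b)) + u b * omit x b ∎)
    where
    u : Fin k → Series
    u a = const (x a) * var

    indicator : ∀ a β → u a * omit x a * const (β B.?* B.1#) ≈ β ?* (u a * omit x a)
    indicator a true  = *-identityʳ (u a * omit x a)
    indicator a false = trans (*-congˡ {u a * omit x a} const-0) (zeroʳ (u a * omit x a))
      where
      const-0 : const B.0# ≈ 0#
      const-0 zero    = B.refl
      const-0 (suc n) = B.refl

  -- The constant term of linear-walks vanishes at a = b.
  closed-𝔻 : ∀ b → walks (avoid b) b * 𝔻 ≈ var * ∂ (omit x b)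
  closed-𝔻 b = linear-*-cancel (x b) _ _ (begin
    linear (x b) * (walks (avoid b) b * 𝔻)    ≈⟨ *-assoc (linear (x b)) (walks (avoid b) b) 𝔻 ⟨
    linear (x b) * walks (avoid b) b * 𝔻      ≈⟨ *-congʳ {𝔻} (linear-walks (avoid b) b) ⟩
    (const (avoid b b B.?* B.1#) + arrivals (avoid b)) * 𝔻
      ≈⟨ *-congʳ {𝔻} (λ n → B.trans (B.+-congʳ (const-avoid n)) (B.+-identityˡ _)) ⟩
    arrivals (avoid b) * 𝔻                    ≈⟨ arrivals-avoid-𝔻 b ⟩
    linear (x b) * (var * ∂ (omit x b))       ∎)
    where
    const-avoid : const (avoid b b B.?* B.1#) ≈ 0#
    const-avoid zero    = B.reflexive (≡.cong (λ β → not β B.?* B.1#) (dec-true (b ≟ᶠ b) ≡.refl))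
    const-avoid (suc n) = B.refl

  -- Proper words whose last letter differs from the first: colorings of a cycle cut open at its
  -- first vertex.
  cycles : Series
  cycles = ∑ (allFin k) λ b → const (x b) * var * walks (avoid b) b

  -- Each x_b is constant and moves under the derivative, so the terms x_b E_b′ add up to the
  -- derivative of ∑ x_b E_b = E′.
  cycles-𝔻 : cycles * 𝔻 ≈ var ^ 2 * ∂ (∂ 𝔼)
  cycles-𝔻 = begin
    cycles * 𝔻                                                     ≈⟨ *-distribʳ-∑ 𝔻 (allFin k) _ ⟩
    ∑ (allFin k) (λ b → const (x b) * var * walks (avoid b) b * 𝔻) ≈⟨ ∑-cong (allFin k) summand ⟩
    ∑ (allFin k) (λ b → var ^ 2 * ∂ (const (x b) * omit x b))      ≈⟨ *-distribˡ-∑ (var ^ 2) (allFin k) _ ⟨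
    var ^ 2 * ∑ (allFin k) (λ b → ∂ (const (x b) * omit x b))
      ≈⟨ *-congˡ {var ^ 2} (∂-∑ (allFin k) (λ b → const (x b) * omit x b)) ⟨
    var ^ 2 * ∂ (∑ (allFin k) (λ b → const (x b) * omit x b))      ≈⟨ *-congˡ {var ^ 2} (∂-cong (∂-elem x)) ⟨
    var ^ 2 * ∂ (∂ 𝔼) ∎
    where
    summand : ∀ b → const (x b) * var * walks (avoid b) b * 𝔻 ≈ var ^ 2 * ∂ (const (x b) * omit x b)
    summand b = begin
      const (x b) * var * walks (avoid b) b * 𝔻    ≈⟨ *-assoc (const (x b) * var) (walks (avoid b) b) 𝔻 ⟩
      const (x b) * var * (walks (avoid b) b * 𝔻)  ≈⟨ *-congˡ {const (x b) * var} (closed-𝔻 b) ⟩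
      const (x b) * var * (var * ∂ (omit x b))
        ≈⟨ solve 3 (λ c v d → c :* v :* (v :* d) := v :* (v :* con 1) :* (c :* d)) refl (const (x b)) var (∂ (omit x b)) ⟩
      var ^ 2 * (const (x b) * ∂ (omit x b))       ≈⟨ *-congˡ {var ^ 2} (∂-const-* (x b) (omit x b)) ⟨
      var ^ 2 * ∂ (const (x b) * omit x b)         ∎

-- Colorings of paths and cycles

does≡ : ∀ {A : Set} (a? : Dec A) b → (A → T b) → (T b → A) → does a? ≡ b
does≡ (yes a) true  f g = ≡.refl
does≡ (yes a) false f g = ⊥-elim (f a)
does≡ (no ¬a) true  f g = ⊥-elim (¬a (g _))
does≡ (no ¬a) false f g = ≡.refl

T-not-does : ∀ {A : Set} (a? : Dec A) → T (not (does a?)) → ¬ A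
T-not-does (no ¬a) _ = ¬a

T-not-does⁻ : ∀ {A : Set} (a? : Dec A) → (¬ A) → T (not (does a?))
T-not-does⁻ (yes a) ¬a = ¬a a
T-not-does⁻ (no _)  _  = _

module _ {k : ℕ} where
  free : Fin k → Bool
  free _ = true

  Proper⇒walk : ∀ {n} a (w : Vec (Fin k) n) → Proper (P (suc n)) (a ∷ w) → T (walk free a w)
  Proper⇒walk a []      proper = _
  Proper⇒walk a (c ∷ w) proper = Equivalence.from T-∧
    ( T-not-does⁻ (a ≟ᶠ c) (proper zero (suc zero) (inj₁ ≡.refl))
    , Proper⇒walk c w λ { u v (inj₁ q) → proper (suc u) (suc v) (inj₁ (≡.cong suc q))
                        ; u v (inj₂ q) → proper (suc u) (suc v) (inj₂ (≡.cong suc q)) })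

  walk⇒Proper : ∀ {n} a (w : Vec (Fin k) n) → T (walk free a w) → Proper (P (suc n)) (a ∷ w)
  walk⇒Proper a w       p zero zero (inj₁ ())
  walk⇒Proper a w       p zero zero (inj₂ ())
  walk⇒Proper a (c ∷ w) p zero (suc zero) _ = T-not-does (a ≟ᶠ c) (proj₁ (Equivalence.to T-∧ p))
  walk⇒Proper a (c ∷ w) p zero (suc (suc v)) (inj₁ ())
  walk⇒Proper a (c ∷ w) p zero (suc (suc v)) (inj₂ ())
  walk⇒Proper a (c ∷ w) p (suc zero) zero _ = T-not-does (a ≟ᶠ c) (proj₁ (Equivalence.to T-∧ p)) ∘ ≡.sym
  walk⇒Proper a (c ∷ w) p (suc (suc u)) zero (inj₁ ())
  walk⇒Proper a (c ∷ w) p (suc (suc u)) zero (inj₂ ())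
  walk⇒Proper a (c ∷ w) p (suc u) (suc v) (inj₁ q) =
    walk⇒Proper c w (proj₂ (Equivalence.to T-∧ p)) u v (inj₁ (ℕₚ.suc-injective q))
  walk⇒Proper a (c ∷ w) p (suc u) (suc v) (inj₂ q) =
    walk⇒Proper c w (proj₂ (Equivalence.to T-∧ p)) u v (inj₂ (ℕₚ.suc-injective q))

  -- Separates the condition on the last letter from the adjacency conditions. On a cycle these are
  -- the closing edge and the path edges.
  walk-last : ∀ t {n} a (w : Vec (Fin k) n) → walk t a w ≡ walk free a w ∧ t (lookup (a ∷ w) (fromℕ n))
  walk-last t a []      = ≡.refl
  walk-last t a (c ∷ w) = ≡.trans (≡.cong (not (does (a ≟ᶠ c)) ∧_) (walk-last t c w))
    (≡.sym (∧-assoc (not (does (a ≟ᶠ c))) _ _))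

  proper-path : ∀ {n} a (w : Vec (Fin k) n) → does (proper? (P (suc n)) (a ∷ w)) ≡ walk free a w
  proper-path {n} a w = does≡ (proper? (P (suc n)) (a ∷ w)) _ (Proper⇒walk a w) (walk⇒Proper a w)

  proper-cycle : ∀ {m} a (w : Vec (Fin k) (2 ℕ.+ m)) →
    does (proper? (C m) (a ∷ w)) ≡ walk (λ c → not (does (a ≟ᶠ c))) a w
  proper-cycle {m} a w = ≡.trans (does≡ (proper? (C m) (a ∷ w)) _ to from) (≡.sym (walk-last _ a w))
    where
    κ    = a ∷ w
    last = fromℕ (2 ℕ.+ m)

    to : Proper (C m) κ → T (walk free a w ∧ not (does (a ≟ᶠ lookup κ last)))
    to proper = Equivalence.from T-∧
      ( Proper⇒walk a w (λ { u v (inj₁ q) → proper u v (inj₁ (inj₁ q))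
                           ; u v (inj₂ q) → proper u v (inj₂ (inj₁ q)) })
      , T-not-does⁻ (a ≟ᶠ lookup κ last)
          (proper zero last (inj₂ (inj₂ (toℕ-fromℕ (2 ℕ.+ m) , ≡.refl)))))

    from : T (walk free a w ∧ not (does (a ≟ᶠ lookup κ last))) → Proper (C m) κ
    from p = proper
      where
      path = walk⇒Proper a w (proj₁ (Equivalence.to T-∧ p))

      closing : ∀ u v → toℕ u ≡ 2 ℕ.+ m → toℕ v ≡ 0 → lookup κ v ≢ lookup κ u
      -- Injectivity of `toℕ` identifies u with the last index, and the final-letter test then says
      -- what is wanted.
      closing u zero    u≡last _ with ≡.refl ← toℕ-injective (≡.trans u≡last (≡.sym (toℕ-fromℕ (2 ℕ.+ m)))) =
        T-not-does (a ≟ᶠ lookup κ last) (proj₂ (Equivalence.to T-∧ p))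

      proper : Proper (C m) κ
      proper u v (inj₁ (inj₁ q))       = path u v (inj₁ q)
      proper u v (inj₁ (inj₂ (q , r))) = closing u v q r ∘ ≡.sym
      proper u v (inj₂ (inj₁ q))       = path u v (inj₂ q)
      proper u v (inj₂ (inj₂ (q , r))) = closing v u q r

-- Stanley's formulas, truncation by truncation

∑-eval : ∀ {A : Set} k (as : List A) F →
  RingOps.∑ Sym as F k ≡ RingOps.∑ (ℤ⟦x⟧ k) as (λ a → F a k)
∑-eval k []       F = ≡.refl
∑-eval k (a ∷ as) F = ≡.cong (RawRing._+_ (ℤ⟦x⟧ k) (F a k)) (∑-eval k as F)

·-eval : ∀ k n f → RingOps._·_ Sym n f k ≡ RingOps._·_ (ℤ⟦x⟧ k) n (f k)
·-eval k zero    f = ≡.refl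
·-eval k (suc n) f = ≡.cong (RawRing._+_ (ℤ⟦x⟧ k) (f k)) (·-eval k n f)

module Truncation (k : ℕ) where
  cr = ℤ⟦x⟧-isCommRing k
  private module B = CommRing cr
  open SeriesRing cr
  open PowerSeries (ℤ⟦x⟧ k)
  open Elementary cr
  open Walks cr {k} x
  open CommRing isCommRing

  𝔻-zero : 𝔻 0 B.≈ B.1#
  𝔻-zero = B.x≈z+y⇒x-y≈z (B.trans (elem-zero (x {k}))
    (B.sym (B.trans (B.+-congˡ (var-*-zero (∂ 𝔼))) (B.+-identityʳ _))))

  path-coeff : ∀ n → X (P n) k B.≈ (1# + arrivals free) n
  path-coeff zero = B.begin
    X (P 0) k                 B.≈⟨ B.+-identityʳ B.1# ⟩
    B.1#                      B.≈⟨ B.+-identityʳ B.1# ⟨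
    B.1# B.+ B.0#             B.≈⟨ B.+-congˡ (∑-const-var-zero (walks free)) ⟨
    B.1# B.+ arrivals free 0  B.∎
  path-coeff (suc n) = B.begin
    X (P (suc n)) k
      B.≈⟨ B.∑-filter (proper? (P (suc n))) (words (allFin k) (suc n)) _ ⟩
    B.∑ (words (allFin k) (suc n)) (λ w → does (proper? (P (suc n)) w) B.?* weight w)
      B.≈⟨ ∑-words n (λ w → does (proper? (P (suc n)) w)) ⟩
    B.∑ (allFin k) (λ c → x c B.* B.∑ (words (allFin k) n) λ w → does (proper? (P (suc n)) (c ∷ w)) B.?* weight w)
      B.≈⟨ B.∑-cong (allFin k) (λ c → B.*-congˡ (B.∑-cong (words (allFin k) n) λ w →
             B.reflexive (≡.cong (B._?* weight w) (proper-path c w)))) ⟩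
    B.∑ (allFin k) (λ c → x c B.* walks free c n)  B.≈⟨ ∑-const-var-suc (walks free) n ⟨
    arrivals free (suc n)                          B.≈⟨ B.+-identityˡ _ ⟨
    B.0# B.+ arrivals free (suc n)                 B.∎

  cycle-coeff : ∀ m → X (C m) k B.≈ cycles (3 ℕ.+ m)
  cycle-coeff m = B.begin
    X (C m) k
      B.≈⟨ B.∑-filter (proper? (C m)) (words (allFin k) (3 ℕ.+ m)) _ ⟩
    B.∑ (words (allFin k) (3 ℕ.+ m)) (λ w → does (proper? (C m) w) B.?* weight w)
      B.≈⟨ ∑-words (2 ℕ.+ m) (λ w → does (proper? (C m) w)) ⟩
    B.∑ (allFin k) (λ c → x c B.* B.∑ (words (allFin k) (2 ℕ.+ m)) λ w → does (proper? (C m) (c ∷ w)) B.?* weight w)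
      B.≈⟨ B.∑-cong (allFin k) (λ c → B.*-congˡ (B.∑-cong (words (allFin k) (2 ℕ.+ m)) λ w →
             B.reflexive (≡.cong (B._?* weight w) (proper-cycle c w)))) ⟩
    B.∑ (allFin k) (λ c → x c B.* walks (avoid c) c (2 ℕ.+ m))
      B.≈⟨ ∑-const-var-suc (λ c → walks (avoid c) c) (2 ℕ.+ m) ⟨
    cycles (3 ℕ.+ m) B.∎

  cycles-zero : cycles 0 B.≈ B.0#
  cycles-zero = ∑-const-var-zero (λ b → walks (avoid b) b)

  -- A one-letter word ends in its own first letter, which `avoid` forbids.
  cycles-one : cycles 1 B.≈ B.0#
  cycles-one = B.begin
    cycles 1                                          B.≈⟨ ∑-const-var-suc (λ b → walks (avoid b) b) 0 ⟩
    B.∑ (allFin k) (λ b → x b B.* walks (avoid b) b 0)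
      B.≈⟨ B.∑-cong (allFin k) (λ b → B.trans (B.*-congˡ (walks-zero b)) (B.zeroʳ (x b))) ⟩
    B.∑ (allFin k) (λ b → B.0#)                       B.≈⟨ B.∑-zero (allFin k) ⟩
    B.0#                                              B.∎
    where
    walks-zero : ∀ b → walks (avoid b) b 0 B.≈ B.0#
    walks-zero b = B.trans
      (B.reflexive (≡.cong (λ β → not β B.?* B.1# B.+ B.0#) (dec-true (b ≟ᶠ b) ≡.refl)))
      (B.+-identityʳ B.0#)

  -- The case n = 2 of cycles-𝔻, since 𝔻 0 ≈ 1 and cycles starts in degree 2.
  cycles-two : cycles 2 B.≈ 2 B.· 𝔼 2
  cycles-two = B.begin
    cycles 2 B.≈⟨ B.solve 3 (λ c d₁ d₂ → c B.:= B.con 0 B.:* d₂ B.:+ (B.con 0 B.:* d₁ B.:+ (c B.:* B.con 1 B.:+ B.con 0)))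
                    B.refl (cycles 2) (𝔻 1) (𝔻 2) ⟩
    B.0# B.* 𝔻 2 B.+ (B.0# B.* 𝔻 1 B.+ (cycles 2 B.* B.1# B.+ B.0#))
      B.≈⟨ B.+-cong (B.*-congʳ cycles-zero) (B.+-cong (B.*-congʳ cycles-one) (B.+-congʳ
             (B.*-congˡ 𝔻-zero))) ⟨
    (cycles * 𝔻) 2                 B.≈⟨ cycles-𝔻 2 ⟩
    (var ^ 2 * ∂ (∂ 𝔼)) 2          B.≈⟨ *-assoc var (var * 1#) (∂ (∂ 𝔼)) 2 ⟩
    (var * (var * 1# * ∂ (∂ 𝔼))) 2 B.≈⟨ var-*-suc (var * 1# * ∂ (∂ 𝔼)) 1 ⟩
    (var * 1# * ∂ (∂ 𝔼)) 1         B.≈⟨ *-congʳ {∂ (∂ 𝔼)} (*-identityʳ var) 1 ⟩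
    (var * ∂ (∂ 𝔼)) 1              B.≈⟨ var-*-suc (∂ (∂ 𝔼)) 0 ⟩
    1 B.· (2 B.· 𝔼 2)              B.≈⟨ B.×-homo-1 _ ⟩
    2 B.· 𝔼 2                      B.∎

  𝒳C-coeff : ∀ n → Defs.𝒳C n k B.≈ cycles n
  𝒳C-coeff 0 = B.sym cycles-zero
  𝒳C-coeff 1 = B.sym cycles-one
  𝒳C-coeff 2 = B.trans (B.reflexive (·-eval k 2 (Defs.e 2))) (B.sym cycles-two)
  𝒳C-coeff (suc (suc (suc m))) = cycle-coeff m

  -- Truncation to k variables. It respects products and `∂`, and equality over `Sym` means equality
  -- after every truncation.
  at : Defs.ZSeries → Series
  at f n = f n k

  *-at : ∀ f g → at (f Defs.* g) ≈ at f * at g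
  *-at f g n = B.reflexive (∑-eval k (upTo (suc n)) _)

  ∂-at : ∀ f → at (Defs.∂ f) ≈ ∂ (at f)
  ∂-at f n = B.reflexive (·-eval k (suc n) (f (suc n)))

  z-at : at Defs.z ≈ var
  z-at 0             = B.refl
  z-at 1             = B.refl
  z-at (suc (suc n)) = B.refl

  1-at : at Defs.1# ≈ 1#
  1-at zero    = B.refl
  1-at (suc n) = B.refl

  z∂-at : ∀ f → at (Defs.z Defs.* Defs.∂ f) ≈ var * ∂ (at f)
  z∂-at f = trans (*-at Defs.z (Defs.∂ f)) (*-cong {at Defs.z} {var} z-at (∂-at f))

  D-at : at Defs.D ≈ 𝔻
  D-at n = B.+-congˡ (B.-‿cong (z∂-at Defs.E n))

  z²∂²-at : ∀ f → at (Defs.z Defs.^ 2 Defs.* Defs.∂ (Defs.∂ f)) ≈ var ^ 2 * ∂ (∂ (at f))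
  z²∂²-at f = trans (*-at (Defs.z Defs.^ 2) (Defs.∂ (Defs.∂ f))) (*-cong {at (Defs.z Defs.^ 2)} {var ^ 2}
    (trans (*-at Defs.z (Defs.z Defs.* Defs.1#)) (*-cong {at Defs.z} {var} z-at
      (trans (*-at Defs.z Defs.1#) (*-cong {at Defs.z} {var} z-at 1-at))))
    (trans (∂-at (Defs.∂ f)) (∂-cong (∂-at f))))

  𝒳P*D-at : at (Defs.𝒳P Defs.* Defs.D) ≈ at Defs.E
  𝒳P*D-at = trans (*-at Defs.𝒳P Defs.D)
    (trans (*-cong {at Defs.𝒳P} {1# + arrivals free} path-coeff D-at) paths-𝔻)

  𝒳C*D-at : at (Defs.𝒳C Defs.* Defs.D) ≈ at (Defs.z Defs.^ 2 Defs.* Defs.∂ (Defs.∂ Defs.E))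
  𝒳C*D-at = trans (*-at Defs.𝒳C Defs.D)
    (trans (*-cong {at Defs.𝒳C} {cycles} 𝒳C-coeff D-at) (trans cycles-𝔻 (sym (z²∂²-at Defs.E))))

open Defs using (eλ; EPositiveSym; EPositive; HasEPositiveNumerator; ZSeries; E; D; e; z; const; ∂; 𝒳P; 𝒳C; _≈_; _+_; _*_; -_; _-_; _·_; _^_; 1#)

𝒳P*D : 𝒳P * D ≈ E
𝒳P*D n k = Truncation.𝒳P*D-at k n

𝒳C*D : 𝒳C * D ≈ z ^ 2 * ∂ (∂ E)
𝒳C*D n k = Truncation.𝒳C*D-at k n

D-zero : RawRing._≈_ Sym (D 0) (RawRing.1# Sym)
D-zero k = B.trans (Truncation.D-at k 0) (Truncation.𝔻-zero k)
  where module B = CommRing (ℤ⟦x⟧-isCommRing k)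

-- e-positivity

Sym-isCommRing : IsCommRing Sym
Sym-isCommRing = record
  { isRing = record
    { +-isAbelianGroup = record
      { isGroup = record
        { isMonoid = record
          { isSemigroup = record
            { isMagma = record
              { isEquivalence = record
                { refl = λ k → R.refl k
                ; sym = λ p k → R.sym k (p k)
                ; trans = λ p q k → R.trans k (p k) (q k)
                }
              ; ∙-cong = λ p q k → R.+-cong k (p k) (q k)
              }
            ; assoc = λ f g h k → R.+-assoc k (f k) (g k) (h k)
            }
          ; identity = (λ f k → R.+-identityˡ k (f k)) , λ f k → R.+-identityʳ k (f k)
          }
        ; inverse = (λ f k → R.-‿inverseˡ k (f k)) , λ f k → R.-‿inverseʳ k (f k)
        ; ⁻¹-cong = λ p k → R.-‿cong k (p k)
        }
      ; comm = λ f g k → R.+-comm k (f k) (g k)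
      }
    ; *-cong = λ p q k → R.*-cong k (p k) (q k)
    ; *-assoc = λ f g h k → R.*-assoc k (f k) (g k) (h k)
    ; *-identity = (λ f k → R.*-identityˡ k (f k)) , λ f k → R.*-identityʳ k (f k)
    ; distrib = (λ f g h k → R.distribˡ k (f k) (g k) (h k)) , λ f g h k → R.distribʳ k (f k) (g k) (h k)
    }
  ; *-comm = λ f g k → R.*-comm k (f k) (g k)
  }
  where module R k = CommRing (ℤ⟦x⟧-isCommRing k)

private
  module Λ = CommRing Sym-isCommRing
  module Z = CommRing (SeriesRing.isCommRing Sym-isCommRing)

open SeriesRing Sym-isCommRing using (const-*; var-*-zero; var-*-suc; ·-coeff)

e-zero : e 0 Λ.≈ Λ.1#
e-zero k = Elementary.elem-zero (ℤ⟦x⟧-isCommRing k) (x {k})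

EPositiveSym-resp : ∀ {f g} → f Λ.≈ g → EPositiveSym g → EPositiveSym f
EPositiveSym-resp f≈g (cs , eq) = cs , Λ.trans f≈g eq

EPositiveSym-+ : ∀ {f g} → EPositiveSym f → EPositiveSym g → EPositiveSym (f Λ.+ g)
EPositiveSym-+ (cs , f≈) (ds , g≈) = cs ++ ds , Λ.trans (Λ.+-cong f≈ g≈) (Λ.sym (Λ.∑-++ cs ds _))

EPositiveSym-·eλ : ∀ c p {f} → f Λ.≈ eλ p → EPositiveSym (c Λ.· f)
EPositiveSym-·eλ c p f≈eλ = (c , p) ∷ [] , Λ.trans (Λ.×-congʳ c f≈eλ) (Λ.sym (Λ.+-identityʳ (c Λ.· eλ p)))

EPositiveSym-·e : ∀ c n → EPositiveSym (c Λ.· e n)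
-- Parts are positive, so e₀ = 1 is represented by the empty partition.
EPositiveSym-·e c zero    = EPositiveSym-·eλ c (record { parts = []; positive = []; decreasing = [] }) e-zero
EPositiveSym-·e c (suc n) = EPositiveSym-·eλ c
  (record { parts = suc n ∷ []; positive = _ ∷ []; decreasing = [-] })
  (Λ.sym (Λ.*-identityʳ (e (suc n))))

EPositiveSym-·e₁e : ∀ c n → EPositiveSym (c Λ.· (e 1 Λ.* e n))
EPositiveSym-·e₁e c zero    = EPositiveSym-·eλ c
  (record { parts = 1 ∷ []; positive = _ ∷ []; decreasing = [-] })
  (Λ.*-congˡ {e 1} e-zero)
-- Parts are weakly decreasing, so the factor e₁ goes last: λ = (n + 1, 1).
EPositiveSym-·e₁e c (suc n) = EPositiveSym-·eλ c
  (record { parts = suc n ∷ 1 ∷ []; positive = _ ∷ _ ∷ []; decreasing = ℕ.s≤s ℕ.z≤n ∷ [-] })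
  (Λ.trans (Λ.*-comm (e 1) (e (suc n))) (Λ.*-congˡ {e (suc n)} (Λ.sym (Λ.*-identityʳ (e 1)))))

-- The series ∑ α(n) eₙ zⁿ. As α takes values in ℕ, such a series is e-positive.
record Diag (f : ZSeries) (α : ℕ → ℕ) : Set where
  constructor diag
  field coeff : ∀ n → f n Λ.≈ α n Λ.· e n

open Diag

Diag-EPositive : ∀ {f α} → Diag f α → EPositive f
Diag-EPositive {α = α} d n = EPositiveSym-resp (coeff d n) (EPositiveSym-·e (α n) n)

Diag-resp : ∀ {f g α} → f ≈ g → Diag g α → Diag f α
Diag-resp f≈g dg .coeff n = Λ.trans (f≈g n) (coeff dg n)

Diag-+ : ∀ {f g α β} → Diag f α → Diag g β → Diag (f + g) (λ n → α n ℕ.+ β n)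
Diag-+ {α = α} {β} df dg .coeff n =
  Λ.trans (Λ.+-cong (coeff df n) (coeff dg n)) (Λ.sym (Λ.×-homo-+ (e n) (α n) (β n)))

Diag-· : ∀ m {f α} → Diag f α → Diag (m · f) (λ n → m ℕ.* α n)
Diag-· m {f} {α} df .coeff n = Λ.trans (Λ.reflexive (·-coeff m f n))
  (Λ.trans (Λ.×-congʳ m (coeff df n)) (Λ.×-assocˡ (e n) m (α n)))

-- The difference of weights is supplied as γ with α = γ + β, because truncated subtraction alone
-- would not guarantee cancellation.
Diag-- : ∀ {f g α β γ} → Diag f α → Diag g β → (∀ n → α n ≡ γ n ℕ.+ β n) → Diag (f - g) γ
Diag-- {α = α} {β} {γ} df dg α≡γ+β .coeff n = Λ.x≈z+y⇒x-y≈z (Λ.trans (coeff df n) (Λ.trans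
  (Λ.×-congˡ {e n} (α≡γ+β n))
  (Λ.trans (Λ.×-homo-+ (e n) (γ n) (β n)) (Λ.+-congˡ {γ n Λ.· e n} (Λ.sym (coeff dg n))))))

-- α − β may be negative where γ compensates for it.
Diag--+ : ∀ {f g h α β γ π} → Diag f α → Diag g β → Diag h γ →
  (∀ n → α n ℕ.+ γ n ≡ π n ℕ.+ β n) → Diag (f - g + h) π
Diag--+ {f} {g} {h} df dg dh eq = Diag-resp
  (Z.trans (Z.+-assoc f (- g) h) (Z.trans (Z.+-congˡ {f} (Z.+-comm (- g) h)) (Z.sym (Z.+-assoc f h (- g)))))
  (Diag-- (Diag-+ df dh) dg eq)

δ₀ δ₁ δ₂ : ℕ → ℕ
δ₀ 0 = 1
δ₀ _ = 0
δ₁ 1 = 1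
δ₁ _ = 0
δ₂ 2 = 1
δ₂ _ = 0

Diag-E : Diag E (λ _ → 1)
Diag-E .coeff n = Λ.sym (Λ.×-homo-1 (e n))

Diag-1 : Diag 1# δ₀
Diag-1 .coeff zero    = Λ.sym (Λ.trans (Λ.×-homo-1 (e 0)) e-zero)
Diag-1 .coeff (suc n) = Λ.refl

Diag-e₁z : Diag (const (e 1) * z) δ₁
Diag-e₁z .coeff 0 = Λ.trans (const-* (e 1) z 0) (Λ.zeroʳ (e 1))
Diag-e₁z .coeff 1 = Λ.trans (const-* (e 1) z 1) (Λ.trans (Λ.*-identityʳ (e 1)) (Λ.sym (Λ.×-homo-1 (e 1))))
Diag-e₁z .coeff (suc (suc n)) = Λ.trans (const-* (e 1) z (2 ℕ.+ n)) (Λ.zeroʳ (e 1))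

Diag-e₂z² : Diag (const (e 2) * z ^ 2) δ₂
Diag-e₂z² .coeff 0 = Λ.trans (const-* (e 2) (z ^ 2) 0)
  (Λ.trans (Λ.*-congˡ {e 2} (var-*-zero (z * 1#))) (Λ.zeroʳ (e 2)))
Diag-e₂z² .coeff (suc n) = Λ.trans (const-* (e 2) (z ^ 2) (suc n))
  (Λ.trans (Λ.*-congˡ {e 2} (Λ.trans (var-*-suc (z * 1#) n) (Z.*-identityʳ z n))) (go n))
  where
  go : ∀ n → e 2 Λ.* z n Λ.≈ δ₂ (suc n) Λ.· e (suc n)
  go 0             = Λ.zeroʳ (e 2)
  go 1             = Λ.trans (Λ.*-identityʳ (e 2)) (Λ.sym (Λ.×-homo-1 (e 2)))
  go (suc (suc n)) = Λ.zeroʳ (e 2)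

z∂-coeff : ∀ f n → (z * ∂ f) n Λ.≈ n Λ.· f n
z∂-coeff f zero    = var-*-zero (∂ f)
z∂-coeff f (suc n) = var-*-suc (∂ f) n

Diag-z∂E : Diag (z * ∂ E) (λ n → n)
Diag-z∂E = diag (z∂-coeff E)

-- With z² E″ = z (z∂) E′, degree n + 1 gets a factor n from z∂ and a factor n + 1 from E′.
Diag-z²∂²E : Diag (z ^ 2 * ∂ (∂ E)) (λ n → pred n ℕ.* n)
Diag-z²∂²E .coeff n = Λ.trans (Z.trans (Z.*-congʳ {∂ (∂ E)} (Z.*-congˡ {z} (Z.*-identityʳ z))) (Z.*-assoc z z (∂ (∂ E))) n) (go n)
  where
  go : ∀ n → (z * (z * ∂ (∂ E))) n Λ.≈ (pred n ℕ.* n) Λ.· e n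
  go zero    = var-*-zero (z * ∂ (∂ E))
  go (suc n) = Λ.trans (var-*-suc (z * ∂ (∂ E)) n) (Λ.trans (z∂-coeff (∂ E) n) (Λ.×-assocˡ (e (suc n)) n (suc n)))

-- In degree n + 1 the coefficient is α(n) e₁ eₙ, a multiple of a single e_λ.
EPositive-e₁z* : ∀ {f α} → Diag f α → EPositive (const (e 1) * z * f)
EPositive-e₁z* {f} {α} df n = EPositiveSym-resp (Z.*-assoc (const (e 1)) z f n)
  (EPositiveSym-resp (const-* (e 1) (z * f) n) (go n))
  where
  go : ∀ n → EPositiveSym (e 1 Λ.* (z * f) n)
  go zero    = [] , Λ.trans (Λ.*-congˡ {e 1} (var-*-zero f)) (Λ.zeroʳ (e 1))
  go (suc n) = EPositiveSym-resp
    (Λ.trans (Λ.*-congˡ {e 1} (Λ.trans (var-*-suc f n) (coeff df n))) (Λ.×-comm-* (α n) (e 1) (e n)))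
    (EPositiveSym-·e₁e (α n) n)

EPositive-+ : ∀ {f g} → EPositive f → EPositive g → EPositive (f + g)
EPositive-+ pf pg n = EPositiveSym-+ (pf n) (pg n)

-- The expressions of part (a)

Diag-a₁ : Diag (z ^ 2 * ∂ (∂ E) - z * ∂ E + const (e 1) * z) (λ n → (n ∸ 2) ℕ.* n)
-- The weight n(n - 1) - n = n(n - 2) is negative only at n = 1, where e₁ z cancels the -1; the
-- truncated `n ∸ 2` gives the same 0.
Diag-a₁ = Diag--+ Diag-z²∂²E Diag-z∂E Diag-e₁z λ
  { 0 → ≡.refl ; 1 → ≡.refl ; (suc (suc m)) → identity m }
  where
  identity : ∀ m → suc m ℕ.* (2 ℕ.+ m) ℕ.+ 0 ≡ m ℕ.* (2 ℕ.+ m) ℕ.+ (2 ℕ.+ m)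
  identity = solve-∀

-- The weight 2n(n - 1) - 3n = n(2n - 5) is -3 at n = 1 and -2 at n = 2, which the two correction
-- terms cancel.
Diag-a₂ : Diag (2 · (z ^ 2 * ∂ (∂ E)) - 3 · (z * ∂ E) + 3 · (const (e 1) * z) + 2 · (const (e 2) * z ^ 2))
  (λ n → n ℕ.* (2 ℕ.* n ∸ 5))
Diag-a₂ = Diag-resp (Z.+-assoc (2 · (z ^ 2 * ∂ (∂ E)) - 3 · (z * ∂ E)) (3 · (const (e 1) * z)) (2 · (const (e 2) * z ^ 2)))
  (Diag--+ (Diag-· 2 Diag-z²∂²E) (Diag-· 3 Diag-z∂E) (Diag-+ (Diag-· 3 Diag-e₁z) (Diag-· 2 Diag-e₂z²)) λ
    { 0 → ≡.refl ; 1 → ≡.refl ; 2 → ≡.refl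
    ; (suc (suc (suc m))) → ≡.trans (identity m)
        (≡.cong (λ d → (3 ℕ.+ m) ℕ.* d ℕ.+ 3 ℕ.* (3 ℕ.+ m)) (≡.sym (≡.cong (_∸ 5) (double m)))) })
  where
  double : ∀ m → 2 ℕ.* (3 ℕ.+ m) ≡ 5 ℕ.+ (1 ℕ.+ 2 ℕ.* m)
  double = solve-∀
  identity : ∀ m → 2 ℕ.* ((2 ℕ.+ m) ℕ.* (3 ℕ.+ m)) ℕ.+ 0 ≡ (3 ℕ.+ m) ℕ.* (1 ℕ.+ 2 ℕ.* m) ℕ.+ 3 ℕ.* (3 ℕ.+ m)
  identity = solve-∀

-- At n = 0 the coefficient is (0 − 1)(0 − 3) = 3.
Diag-a₃ : Diag (z ^ 2 * ∂ (∂ E) - 3 · (z * ∂ E) + 3 · E + const (e 2) * z ^ 2)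
  (λ n → 3 ℕ.* δ₀ n ℕ.+ (n ∸ 1) ℕ.* (n ∸ 3))
Diag-a₃ = Diag-resp (Z.+-assoc (z ^ 2 * ∂ (∂ E) - 3 · (z * ∂ E)) (3 · E) (const (e 2) * z ^ 2))
  (Diag--+ Diag-z²∂²E (Diag-· 3 Diag-z∂E) (Diag-+ (Diag-· 3 Diag-E) Diag-e₂z²) λ
    { 0 → ≡.refl ; 1 → ≡.refl ; 2 → ≡.refl ; (suc (suc (suc m))) → identity m })
  where
  identity : ∀ m → (2 ℕ.+ m) ℕ.* (3 ℕ.+ m) ℕ.+ 3 ≡ (2 ℕ.+ m) ℕ.* m ℕ.+ 3 ℕ.* (3 ℕ.+ m)
  identity = solve-∀

-- The numerators of part (b)

private
  c A B : ZSeries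
  c = const (e 1) * z
  A = z ^ 2 * ∂ (∂ E)
  B = z * ∂ E

  D+B≈E : D + B ≈ E
  D+B≈E = Z.[x-y]+y≈x E B

-- Both numerators are verified after adding enough terms to both sides to
-- turn the claim into a semiring identity.
module PathNumerator where
  -- The numerator is B + c (B - E). Moving c = e₁ z from the first summand to the second costs B
  -- its degree 1 term and cancels the constant term -1 of B - E.
  N₁ N₂ N : ZSeries
  N₁ = B - c
  N₂ = B - E + 1#
  N = N₁ + c * N₂

  Diag-N₁ : Diag N₁ (λ n → n ∸ δ₁ n)
  Diag-N₁ = Diag-- Diag-z∂E Diag-e₁z λ
    { 0 → ≡.refl ; 1 → ≡.refl ; (suc (suc m)) → ≡.sym (ℕₚ.+-identityʳ (2 ℕ.+ m)) }

  Diag-N₂ : Diag N₂ pred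
  Diag-N₂ = Diag--+ Diag-z∂E Diag-E Diag-1 λ
    { 0 → ≡.refl ; (suc m) → ≡.trans (ℕₚ.+-identityʳ (suc m)) (ℕₚ.+-comm 1 m) }

  positive : EPositive N
  positive = EPositive-+ (Diag-EPositive Diag-N₁) (EPositive-e₁z* Diag-N₂)

  -- Since 𝒳P D = E, the numerator has to be E - (1 + c) D, where D = E - B.
  N+[1+c]D≈E : N + (1# + c) * D ≈ E
  -- `K` collects what is subtracted inside c N₂, N₁ and (1 + c) D: the terms c E, c and (1 + c) B.
  N+[1+c]D≈E = Z.+-cancelʳ K _ _ (Z.begin
    (N₁ + c * N₂ + (1# + c) * D) + K
      Z.≈⟨ Z.solve 6 (λ n₁ n₂ c d b e →
             (n₁ Z.:+ c Z.:* n₂ Z.:+ (Z.con 1 Z.:+ c) Z.:* d) Z.:+ (c Z.:* e Z.:+ c Z.:+ (Z.con 1 Z.:+ c) Z.:* b) Z.:=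
             (n₁ Z.:+ c) Z.:+ c Z.:* (n₂ Z.:+ e) Z.:+ (Z.con 1 Z.:+ c) Z.:* (d Z.:+ b)) Z.refl N₁ N₂ c D B E ⟩
    (N₁ + c) + c * (N₂ + E) + (1# + c) * (D + B)
      Z.≈⟨ Z.+-cong (Z.+-cong (Z.[x-y]+y≈x B c) (Z.*-congˡ {c} (Z.[x-y+z]+y≈x+z B E 1#))) (Z.*-congˡ {1# + c} D+B≈E) ⟩
    B + c * (B + 1#) + (1# + c) * E
      Z.≈⟨ Z.solve 3 (λ c b e → b Z.:+ c Z.:* (b Z.:+ Z.con 1) Z.:+ (Z.con 1 Z.:+ c) Z.:* e Z.:=
             e Z.:+ (c Z.:* e Z.:+ c Z.:+ (Z.con 1 Z.:+ c) Z.:* b)) Z.refl c B E ⟩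
    E + K Z.∎)
    where K = c * E + c + (1# + c) * B

  quotient : (𝒳P - (1# + c)) * D ≈ N
  quotient = Z.+-cancelʳ ((1# + c) * D) _ _ (Z.begin
    (𝒳P - (1# + c)) * D + (1# + c) * D     Z.≈⟨ Z.distribʳ D (𝒳P - (1# + c)) (1# + c) ⟨
    ((𝒳P - (1# + c)) + (1# + c)) * D       Z.≈⟨ Z.*-congʳ {D} (Z.[x-y]+y≈x 𝒳P (1# + c)) ⟩
    𝒳P * D                                 Z.≈⟨ 𝒳P*D ⟩
    E                                      Z.≈⟨ N+[1+c]D≈E ⟨
    N + (1# + c) * D                       Z.∎)

module CycleNumerator where
  -- The numerator is (A - B) + c (A - B + E). Moving c from the second summand to the first turns A
  -- - B into expression (a)(i) and removes the constant term 1 of A - B + E.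
  N₁ N₂ N : ZSeries
  N₁ = A - B + c
  N₂ = A - (B + 1#) + E
  N = N₁ + c * N₂

  -- The weight is n(n - 1) - n + 1 = (n - 1)², except in degree 0, where the subtracted 1 leaves 0,
  -- as does `pred 0`.
  Diag-N₂ : Diag N₂ (λ n → pred n ℕ.* pred n)
  Diag-N₂ = Diag--+ Diag-z²∂²E (Diag-+ Diag-z∂E Diag-1) Diag-E λ
    { 0 → ≡.refl ; (suc m) → identity m }
    where
    identity : ∀ m → m ℕ.* suc m ℕ.+ 1 ≡ m ℕ.* m ℕ.+ (suc m ℕ.+ 0)
    identity = solve-∀

  positive : EPositive N
  positive = EPositive-+ (Diag-EPositive Diag-a₁) (EPositive-e₁z* Diag-N₂)

  -- By Stanley's formulas the cleared expression is (1 + c)(𝒳C D + D) - 𝒳P D = (1 + c)(A + D) - E.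
  N+E≈[1+c][A+D] : N + E ≈ (1# + c) * (A + D)
  N+E≈[1+c][A+D] = Z.+-cancelʳ K _ _ (Z.begin
    (N₁ + c * N₂ + E) + K
      Z.≈⟨ Z.solve 5 (λ n₁ n₂ c b e →
             (n₁ Z.:+ c Z.:* n₂ Z.:+ e) Z.:+ (c Z.:+ (Z.con 1 Z.:+ c) Z.:* b) Z.:=
             (n₁ Z.:+ b) Z.:+ c Z.:* (n₂ Z.:+ (b Z.:+ Z.con 1)) Z.:+ e) Z.refl N₁ N₂ c B E ⟩
    (N₁ + B) + c * (N₂ + (B + 1#)) + E
      Z.≈⟨ Z.+-congʳ {E} (Z.+-cong (Z.[x-y+z]+y≈x+z A B c) (Z.*-congˡ {c} (Z.[x-y+z]+y≈x+z A (B + 1#) E))) ⟩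
    (A + c) + c * (A + E) + E
      Z.≈⟨ Z.solve 3 (λ a c e → (a Z.:+ c) Z.:+ c Z.:* (a Z.:+ e) Z.:+ e Z.:=
             (Z.con 1 Z.:+ c) Z.:* (a Z.:+ e) Z.:+ c) Z.refl A c E ⟩
    (1# + c) * (A + E) + c
      Z.≈⟨ Z.+-congʳ {c} (Z.*-congˡ {1# + c} (Z.+-congˡ {A} D+B≈E)) ⟨
    (1# + c) * (A + (D + B)) + c
      Z.≈⟨ Z.solve 4 (λ a c d b → (Z.con 1 Z.:+ c) Z.:* (a Z.:+ (d Z.:+ b)) Z.:+ c Z.:=
             (Z.con 1 Z.:+ c) Z.:* (a Z.:+ d) Z.:+ (c Z.:+ (Z.con 1 Z.:+ c) Z.:* b)) Z.refl A c D B ⟩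
    (1# + c) * (A + D) + K Z.∎)
    where K = c + (1# + c) * B

  quotient : ((1# + c) * 𝒳C - 𝒳P + 1# + c) * D ≈ N
  quotient = Z.+-cancelʳ E _ _ (Z.begin
    -- Writing E as 𝒳P D cancels the negative term 𝒳P of `F`.
    F * D + E                                 Z.≈⟨ Z.+-congˡ {F * D} 𝒳P*D ⟨
    F * D + 𝒳P * D                            Z.≈⟨ Z.distribʳ D F 𝒳P ⟨
    (F + 𝒳P) * D                              Z.≈⟨ Z.*-congʳ {D} (Z.+-congʳ {𝒳P} (Z.+-assoc ((1# + c) * 𝒳C - 𝒳P) 1# c)) ⟩
    (((1# + c) * 𝒳C - 𝒳P + (1# + c)) + 𝒳P) * D
      Z.≈⟨ Z.*-congʳ {D} (Z.[x-y+z]+y≈x+z ((1# + c) * 𝒳C) 𝒳P (1# + c)) ⟩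
    ((1# + c) * 𝒳C + (1# + c)) * D
      Z.≈⟨ Z.solve 3 (λ s w d → (s Z.:* w Z.:+ s) Z.:* d Z.:= s Z.:* (w Z.:* d Z.:+ d)) Z.refl (1# + c) 𝒳C D ⟩
    (1# + c) * (𝒳C * D + D)                   Z.≈⟨ Z.*-congˡ {1# + c} (Z.+-congʳ {D} 𝒳C*D) ⟩
    (1# + c) * (A + D)                        Z.≈⟨ N+E≈[1+c][A+D] ⟨
    N + E                                     Z.∎)
    where F = (1# + c) * 𝒳C - 𝒳P + 1# + c

lemma3p3 : ( EPositive (z ^ 2 * ∂ (∂ E) - z * ∂ E + const (e 1) * z)
    × EPositive (2 · (z ^ 2 * ∂ (∂ E)) - 3 · (z * ∂ E) + 3 · (const (e 1) * z) + 2 · (const (e 2) * z ^ 2))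
    × EPositive (z ^ 2 * ∂ (∂ E) - 3 · (z * ∂ E) + 3 · E + const (e 2) * z ^ 2))
    × ( HasEPositiveNumerator (𝒳P - (1# + const (e 1) * z))
    × HasEPositiveNumerator ((1# + const (e 1) * z) * 𝒳C - 𝒳P + 1# + const (e 1) * z))
lemma3p3 =
  (Diag-EPositive Diag-a₁ , Diag-EPositive Diag-a₂ , Diag-EPositive Diag-a₃) ,
  (PathNumerator.N , PathNumerator.positive , D-zero , PathNumerator.quotient) ,
  (CycleNumerator.N , CycleNumerator.positive , D-zero , CycleNumerator.quotient)
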